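{- For every connected graph $G$ the following assertions are equivalent: (i) $G$ is countably determined. (ii) $G$ contains a countable normal tree that contains a ray from every end of $G$.
   Context: Graphs may be infinite of any cardinality. Countable means finite or countably infinite. A ray is a one-way infinite path. Two rays in $G$ are equivalent if no finite set of vertices separates them; the equivalence classes are the ends of $G$. A direction of $G$ is a map $f$ that assigns to every finite set $X\subseteq V(G)$ a component $f(X)$ of $G-X$ such that $f(X)\supseteq f(X')$ whenever $X\subseteq X'$. A directional choice in $G$ is a pair $(X,C)$ of a finite set $X\subseteq V(G)$ and a component $C$ of $G-X$. It distinguishes a direction $f$ from another direction $h$ if $f(X)=C$ and $h(X)\neq C$. The graph $G$ is countably determined if there is a countable set of directional choices in $G$ that distinguish every two directions of $G$ from each other (i.e. for any two distinct directions $f,h$, some directional choice in the set distinguishes $f$ from $h$). The tree-order of a rooted tree $(T,r)$ is given by $u\le v$ if $u$ lies on the path $rTv$ in $T$. A rooted tree $T\subseteq G$ is normal in $G$ if the endvertices of every $T$-path in $G$ are comparable in the tree-order of $T$, where a $T$-path in $G$ is a non-trivial path that meets $T$ exactly in its endvertices. A normal tree need not be spanning. -}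

module Defs where

open import Level using (Level; suc; _⊔_)
open import Data.Nat as ℕ using (ℕ)
open import Data.List using (List; []; _∷_; length)
open import Data.List.Membership.Propositional using (_∈_; _∉_)
open import Data.List.Relation.Binary.Subset.Propositional renaming (_⊆_ to _⊆ˡ_)
open import Data.List.Relation.Unary.Unique.Propositional using (Unique)
open import Data.Product using (Σ; ∃; ∃-syntax; Σ-syntax; _×_)
open import Data.Sum using (_⊎_)
open import Function.Bundles using (_⇔_)
open import Function.Definitions using (Injective)
open import Relation.Binary.Construct.Closure.ReflexiveTransitive using (Star; ε; _◅_)
open import Relation.Binary.Core using (Rel; _⇒_)
open import Relation.Binary.Definitions using (Symmetric; Irreflexive)
open import Relation.Binary.PropositionalEquality using (_≡_)
open import Relation.Nullary using (¬_)
open import Relation.Unary using (Pred; U; _⊆_; _≐_)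

private variable
  a p r ℓ : Level
  A : Set a

-- P is finite or countably infinite, up to the equivalence _≈_: it injects
-- into ℕ.  The code of an element outside P is irrelevant.
Countable : {A : Set a} → Rel A r → Pred A p → Set (a ⊔ r ⊔ p)
Countable {A = A} _≈_ P =
  Σ[ code ∈ (A → ℕ) ] (∀ {x y} → P x → P y → code x ≡ code y → x ≈ y)

vertices : {R : Rel A r} {u v : A} → Star R u v → List A
vertices {u = u} ε       = u ∷ []
vertices {u = u} (_ ◅ w) = u ∷ vertices w

record Path {A : Set a} (R : Rel A r) (u v : A) : Set (a ⊔ r) where
  field
    walk   : Star R u v
    simple : Unique (vertices walk)

  support : List A
  support = vertices walk

open Path public using (support)

-- Connectedness of the graph with vertex set P and edge relation R; R is meant
-- to relate elements of P only, so that its paths stay inside P.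
IsConnected : {A : Set a} → Pred A p → Rel A r → Set (a ⊔ p ⊔ r)
IsConnected P R = ∃ P × (∀ {u v} → P u → P v → Path R u v)

-- No path on at least three vertices is closed up by an edge.
Acyclic : {A : Set a} → Rel A r → Set (a ⊔ r)
Acyclic R = ∀ {u v} (π : Path R u v) → 3 ℕ.≤ length (support π) → ¬ R v u

record Graph (ℓ : Level) : Set (suc ℓ) where
  infix 4 _~_
  field
    V      : Set ℓ
    _~_    : Rel V ℓ
    sym    : Symmetric _~_
    irrefl : Irreflexive _≡_ _~_

module _ (G : Graph ℓ) where
  open Graph G

  Connected : Set ℓ
  Connected = IsConnected U _~_

  Induced : Pred V ℓ → Rel V ℓ
  Induced C u v = C u × C v × u ~ v

  -- A finite X ⊆ V(G) is given by a list enumerating it; order and repetitions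
  -- play no role below.
  Avoids : List V → Pred V ℓ → Set ℓ
  Avoids X C = ∀ {v} → C v → v ∉ X

  -- C is the vertex set of a component, i.e. of a maximal connected subgraph,
  -- of G − X.  Such a subgraph is induced, so vertex sets suffice.
  record IsComponent (X : List V) (C : Pred V ℓ) : Set (suc ℓ) where
    field
      avoids    : Avoids X C
      connected : IsConnected C (Induced C)
      maximal   : ∀ (D : Pred V ℓ) → Avoids X D → IsConnected D (Induced D) →
                  C ⊆ D → D ⊆ C

  -- Monotonicity implies that `at X` depends only on the set that X enumerates.
  record Direction : Set (suc ℓ) where
    field
      at          : List V → Pred V ℓ
      isComponent : ∀ X → IsComponent X (at X)
      monotone    : ∀ {X X′} → X ⊆ˡ X′ → at X′ ⊆ at X

  _≈ᵈ_ : Rel Direction ℓ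
  f ≈ᵈ h = ∀ X → Direction.at f X ≐ Direction.at h X

  record DirectionalChoice : Set (suc ℓ) where
    field
      X           : List V
      C           : Pred V ℓ
      isComponent : IsComponent X C

  _≈ᶜ_ : Rel DirectionalChoice ℓ
  c ≈ᶜ d = c.X ⊆ˡ d.X × d.X ⊆ˡ c.X × c.C ≐ d.C
    where
    module c = DirectionalChoice c
    module d = DirectionalChoice d

  Distinguishes : DirectionalChoice → Direction → Direction → Set ℓ
  Distinguishes c f h = Direction.at f X ≐ C × ¬ (Direction.at h X ≐ C)
    where open DirectionalChoice c

  CountablyDetermined : Set (suc (suc ℓ))
  CountablyDetermined =
    Σ[ S ∈ Pred DirectionalChoice (suc ℓ) ]
      Countable _≈ᶜ_ S ×
      (∀ (f h : Direction) → ¬ (f ≈ᵈ h) → ∃[ c ] (S c × Distinguishes c f h))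

  record Ray : Set ℓ where
    field
      at        : ℕ → V
      injective : Injective _≡_ _≡_ at
      adjacent  : ∀ n → at n ~ at (ℕ.suc n)

  Separates : List V → Ray → Ray → Set ℓ
  Separates X R R′ =
    ∀ m n (π : Path _~_ (Ray.at R m) (Ray.at R′ n)) → ∃[ x ] (x ∈ X × x ∈ support π)

  Equivalent : Rel Ray ℓ
  Equivalent R R′ = ∀ X → ¬ Separates X R R′

  record End : Set (suc ℓ) where
    field
      member  : Pred Ray ℓ
      isClass : ∃[ R ] (member ≐ Equivalent R)

  record Subgraph : Set (suc ℓ) where
    field
      vertex  : Pred V ℓ
      edge    : Rel V ℓ
      edge⇒~  : edge ⇒ _~_
      sym     : Symmetric edge
      source  : ∀ {u v} → edge u v → vertex u

  _ContainsRay_ : Subgraph → Ray → Set ℓ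
  H ContainsRay R = ∀ n → Subgraph.edge H (Ray.at R n) (Ray.at R (ℕ.suc n))

  record RootedTree : Set (suc ℓ) where
    field
      subgraph : Subgraph
    open Subgraph subgraph public
    field
      connected : IsConnected vertex edge
      acyclic   : Acyclic edge
      root      : V
      root∈     : vertex root

    -- u lies on the path in the tree from the root to v; that path is unique.
    _≤ᵀ_ : Rel V ℓ
    u ≤ᵀ v = Σ[ π ∈ Path edge root v ] u ∈ support π

  -- A non-trivial path in G, i.e. one with at least two vertices, whose
  -- vertices in T are precisely its endvertices.
  IsTPath : (T : RootedTree) {u v : V} → Path _~_ u v → Set ℓ
  IsTPath T {u} {v} π =
    2 ℕ.≤ length (support π) ×
    (∀ x → (x ∈ support π × RootedTree.vertex T x) ⇔ (x ≡ u ⊎ x ≡ v))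

  Normal : RootedTree → Set ℓ
  Normal T = ∀ {u v} (π : Path _~_ u v) → IsTPath T π → u ≤ᵀ v ⊎ v ≤ᵀ u
    where open RootedTree T

  HasCountableNormalTreeWithAllEnds : Set (suc ℓ)
  HasCountableNormalTreeWithAllEnds =
    Σ[ T ∈ RootedTree ]
      Normal T ×
      Countable _≡_ (RootedTree.vertex T) ×
      (∀ (ω : End) → ∃[ R ] (End.member ω R × RootedTree.subgraph T ContainsRay R))

{-# OPTIONS --safe #-}

-- Every direction f is that of a ray: if every f(X) contains a vertex v
-- dominating f (v ∈ f(Y) for all Y avoiding v), thread a ray through such
-- vertices; otherwise shrink f(X) by cuts and follow the cuts.
--
-- (ii) ⇒ (i).  For finite X₀, the down-closure X of X₀ ∩ T separates in G any
-- two vertices of T outside X that X₀ separates, by normality.  So the choices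
-- (X , C) with X ⊆ T and C meeting T suffice, and these are countably many.
--
-- (i) ⇒ (ii).  Let U be the union of the sets X of the countably many choices.
-- Every countable set lies in a countable normal tree.  If T ⊇ U is a normal
-- tree and f(Y) meets T for every finite Y ⊆ T, then f can be followed upwards
-- along a ray of T whose direction is f, as no choice tells them apart.  Let T₀
-- be a normal tree containing U.  The directions f with some f(Y) avoiding T₀
-- are countably many, hence a normal tree T₁ containing T₀ and a ray of each
-- of them contains a ray of every end.

module Submission where

open import Defs
open import Level using (Level; suc; _⊔_; Lift; lift; lower)
open import Axiom.ExcludedMiddle using (ExcludedMiddle)
open import Data.Empty using (⊥-elim)
open import Data.List using (List; []; _∷_; _++_; length; map; concatMap; filter; upTo)
open import Data.List.Membership.Propositional using (_∈_; _∉_)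
open import Data.List.Membership.Propositional.Properties
  using (∈-++⁺ˡ; ∈-++⁺ʳ; ∈-++⁻; ∈-concatMap⁺; ∈-concatMap⁻; ∈-upTo⁺; ∈-map⁺; ∈-filter⁺; ∈-filter⁻)
import Data.List.Properties as Listₚ
open import Data.List.Relation.Unary.All using (All; []; _∷_)
import Data.List.Relation.Unary.All as All
import Data.List.Relation.Unary.Any as Any
open import Data.List.Relation.Unary.Any using (Any; here; there)
open import Data.List.Relation.Unary.Unique.Propositional using (Unique; []; _∷_)
open import Data.List.Relation.Binary.Subset.Propositional renaming (_⊆_ to _⊆ˡ_)
open import Data.Nat as ℕ using (ℕ; zero; _≤_; _<_; z≤n; s≤s; _+_)
  renaming (suc to 1+)
import Data.Nat.Properties as ℕₚ
open import Data.Nat.Binary using (ℕᵇ; 2[1+_]; 1+[2_]) renaming (zero to 0ᵇ)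
import Data.Nat.Binary as ℕᵇ
open import Data.Nat.Binary.Properties using (toℕ-injective; 1+[2_]-injective; 2[1+_]-injective)
open import Data.Product using (∃; ∃-syntax; Σ-syntax; _×_; _,_; proj₁; proj₂; map₂)
open import Data.Sum using (_⊎_; inj₁; inj₂; [_,_]′)
open import Function using (_∘_; id; case_of_)
open import Function.Bundles using (_⇔_; mk⇔; Equivalence)
open import Relation.Binary.Construct.Closure.ReflexiveTransitive as Star
  using (Star; ε; _◅_; _◅◅_)
open import Relation.Binary.Core using (Rel; _⇒_)
open import Relation.Binary.Definitions using (Symmetric; DecidableEquality; tri<; tri≈; tri>)
open import Relation.Binary.PropositionalEquality
  using (_≡_; _≢_; refl; sym; trans; cong; subst)
open import Relation.Nullary using (¬_; Dec; yes; no)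
open import Relation.Nullary.Decidable using (map′)
open import Relation.Unary using (Pred; _⊆_; _≐_)

private variable
  a b p r s : Level

-- Walks and paths

Restrict : {A : Set a} → Pred A p → Rel A r → Rel A (p ⊔ r)
Restrict P R u v = P u × P v × R u v

module _ {A : Set a} {R : Rel A r} where

  source∈ : ∀ {u v} (w : Star R u v) → u ∈ vertices w
  source∈ ε       = here refl
  source∈ (_ ◅ _) = here refl

  target∈ : ∀ {u v} (w : Star R u v) → v ∈ vertices w
  target∈ ε       = here refl
  target∈ (_ ◅ w) = there (target∈ w)

  vertices-all : {P : Pred A p} → (∀ {u v} → R u v → P v) →
                 ∀ {u v} → P u → (w : Star R u v) → ∀ {x} → x ∈ vertices w → P x
  vertices-all step Pu ε       (here refl) = Pu
  vertices-all step Pu (_ ◅ _) (here refl) = Pu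
  vertices-all step Pu (e ◅ w) (there x∈)  = vertices-all step (step e) w x∈

  restrict : {P : Pred A p} → ∀ {u v} (w : Star R u v) →
             (∀ {x} → x ∈ vertices w → P x) → Star (Restrict P R) u v
  restrict ε       inP = ε
  restrict (e ◅ w) inP =
    (inP (here refl) , inP (there (source∈ w)) , e) ◅ restrict w (inP ∘ there)

  restrict-closed : {P : Pred A p} → (∀ {u v} → P u → R u v → P v) →
                    ∀ {u v} → P u → Star R u v → Star (Restrict P R) u v
  restrict-closed step Pu ε       = ε
  restrict-closed step Pu (e ◅ w) =
    (Pu , step Pu e , e) ◅ restrict-closed step (step Pu e) w

  take-to : ∀ {u v z} (w : Star R u v) → z ∈ vertices w →
            Σ[ w′ ∈ Star R u z ]
              vertices w′ ⊆ˡ vertices w × (Unique (vertices w) → Unique (vertices w′))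
  take-to ε       (here refl) = ε , id , id
  take-to (e ◅ w) (here refl) = ε , (λ { (here refl) → here refl }) , λ _ → [] ∷ []
  take-to (e ◅ w) (there z∈)  with take-to w z∈
  ... | w′ , sub , uniq =
    e ◅ w′ ,
    (λ { (here refl) → here refl ; (there x∈) → there (sub x∈) }) ,
    λ { (u∉ ∷ u) → All.tabulate (All.lookup u∉ ∘ sub) ∷ uniq u }

  drop-to : ∀ {u v z} (w : Star R u v) → z ∈ vertices w →
            Σ[ w′ ∈ Star R z v ]
              vertices w′ ⊆ˡ vertices w × (Unique (vertices w) → Unique (vertices w′))
  drop-to ε       (here refl) = ε , id , id
  drop-to (e ◅ w) (here refl) = e ◅ w , id , id
  drop-to (e ◅ w) (there z∈)  with drop-to w z∈
  ... | w′ , sub , uniq = w′ , there ∘ sub , λ { (_ ∷ u) → uniq u }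

  -- On a tree path from the root, this puts `y` on the path from the root to every later vertex
  -- `z`, hence below `z` in the tree-order.
  take-past : ∀ {u v y z} (w : Star R u v) (y∈ : y ∈ vertices w) →
              z ∈ vertices (proj₁ (drop-to w y∈)) →
              Σ[ w′ ∈ Star R u z ]
                y ∈ vertices w′ × vertices w′ ⊆ˡ vertices w ×
                (Unique (vertices w) → Unique (vertices w′))
  take-past ε       (here refl) (here refl) = ε , here refl , id , id
  take-past (e ◅ w) (here refl) z∈ with take-to (e ◅ w) z∈
  ... | w′ , sub , uniq = w′ , source∈ w′ , sub , uniq
  take-past (e ◅ w) (there y∈)  z∈ with take-past w y∈ z∈
  ... | w′ , y∈′ , sub , uniq =
    e ◅ w′ , there y∈′ ,
    (λ { (here refl) → here refl ; (there x∈) → there (sub x∈) }) ,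
    λ { (u∉ ∷ u) → All.tabulate (All.lookup u∉ ∘ sub) ∷ uniq u }

  -- Loops are removed from the end backwards: if the head recurs on the path already found for the
  -- rest, that path is cut down to start at the recurrence.
  toPath : DecidableEquality A → ∀ {u v} (w : Star R u v) →
           Σ[ π ∈ Path R u v ] support π ⊆ˡ vertices w
  toPath _≟_ ε = record { walk = ε ; simple = [] ∷ [] } , id
  toPath _≟_ {u} (e ◅ w) with toPath _≟_ w
  ... | π , sub with Any.any? (u ≟_) (support π)
  ...   | yes u∈ with drop-to (Path.walk π) u∈
  ...     | w′ , sub′ , uniq =
    record { walk = w′ ; simple = uniq (Path.simple π) } , there ∘ sub ∘ sub′
  toPath _≟_ (e ◅ w) | π , sub | no u∉ =
    record { walk = e ◅ Path.walk π ; simple = All.tabulate (λ { x∈ refl → u∉ x∈ }) ∷ Path.simple π } ,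
    λ { (here refl) → here refl ; (there x∈) → there (sub x∈) }

vertices-map : {A : Set a} {R : Rel A r} {S : Rel A s} (f : R ⇒ S) →
               ∀ {u v} (w : Star R u v) → vertices (Star.map f w) ≡ vertices w
vertices-map f ε       = refl
vertices-map f (e ◅ w) = cong (_ ∷_) (vertices-map f w)

mapPath : {A : Set a} {R : Rel A r} {S : Rel A s} → R ⇒ S →
          ∀ {u v} (π : Path R u v) → Σ[ ρ ∈ Path S u v ] support ρ ≡ support π
mapPath f π = record
  { walk   = Star.map f (Path.walk π)
  ; simple = subst Unique (sym (vertices-map f (Path.walk π))) (Path.simple π)
  } , vertices-map f (Path.walk π)

module _ {A : Set a} {R : Rel A r} {P : Pred A p} where

  restricted-vertices : ∀ {u v} → P u → (w : Star (Restrict P R) u v) →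
                        ∀ {x} → x ∈ vertices w → P x
  restricted-vertices = vertices-all (proj₁ ∘ proj₂)

  unrestrict : Restrict P R ⇒ R
  unrestrict = proj₂ ∘ proj₂

module _ {A : Set a} {R : Rel A r} (_≟_ : DecidableEquality A)
         (R-sym : Symmetric R) (acyclic : Acyclic R) where

  -- Common first edges are stripped off. Where the paths part, at `u`, their remainders yield a
  -- path between the two successors of `u` that avoids `u`; the two edges at `u` close it to a
  -- cycle.
  acyclic⇒unique-path : ∀ {u v} (w w′ : Star R u v) →
    Unique (vertices w) → Unique (vertices w′) → vertices w ≡ vertices w′
  acyclic⇒unique-path ε ε _ _ = refl
  acyclic⇒unique-path ε (_ ◅ w′) _ (u∉ ∷ _) = ⊥-elim (All.lookup u∉ (target∈ w′) refl)
  acyclic⇒unique-path (_ ◅ w) ε (u∉ ∷ _) _ = ⊥-elim (All.lookup u∉ (target∈ w) refl)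
  acyclic⇒unique-path {u} (_◅_ {j = x} e w) (_◅_ {j = y} e′ w′) (u∉ ∷ uw) (u∉′ ∷ uw′) with x ≟ y
  ... | yes refl = cong (u ∷_) (acyclic⇒unique-path w w′ uw uw′)
  ... | no x≢y = ⊥-elim (acyclic cycle (long (Path.walk ρ)) (R-sym e′))
    where
    x→y : Star (Restrict (u ≢_) R) x y
    x→y = restrict w (All.lookup u∉) ◅◅
          Star.reverse (λ (p , q , e) → q , p , R-sym e) (restrict w′ (All.lookup u∉′))
    π = toPath _≟_ x→y
    ρ+ = mapPath (unrestrict {R = R} {P = u ≢_}) (proj₁ π)
    ρ = proj₁ ρ+
    cycle : Path R u y
    cycle = record
      { walk   = e ◅ Path.walk ρ
      ; simple = All.tabulate (λ z∈ → restricted-vertices {R = R} {P = u ≢_} (All.lookup u∉ (source∈ w)) x→y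
                   (proj₂ π (subst (_ ∈_) (proj₂ ρ+) z∈))) ∷ Path.simple ρ }
    long : (ww : Star R x y) → 3 ≤ 1+ (length (vertices ww))
    long ε       = ⊥-elim (x≢y refl)
    long (_ ◅ ε) = ℕₚ.≤-refl
    long (_ ◅ (_ ◅ _)) = s≤s (s≤s (s≤s z≤n))

-- Countable sets

-- In bijective binary notation, an entry n becomes n digits two followed by a digit one, so the
-- list can be read off again.
encodeᵇ : List ℕ → ℕᵇ
encodeᵇ []       = 0ᵇ
encodeᵇ (n ∷ ns) = unary n
  where
  unary : ℕ → ℕᵇ
  unary zero   = 1+[2 encodeᵇ ns ]
  unary (1+ n) = 2[1+ unary n ]

encodeᵇ-injective : ∀ xs ys → encodeᵇ xs ≡ encodeᵇ ys → xs ≡ ys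
encodeᵇ-injective [] [] _ = refl
encodeᵇ-injective [] (zero ∷ _) ()
encodeᵇ-injective [] (1+ _ ∷ _) ()
encodeᵇ-injective (zero ∷ _) [] ()
encodeᵇ-injective (1+ _ ∷ _) [] ()
encodeᵇ-injective (zero ∷ xs) (zero ∷ ys) eq = cong (zero ∷_) (encodeᵇ-injective xs ys (1+[2_]-injective eq))
encodeᵇ-injective (zero ∷ _) (1+ _ ∷ _) ()
encodeᵇ-injective (1+ _ ∷ _) (zero ∷ _) ()
encodeᵇ-injective (1+ x ∷ xs) (1+ y ∷ ys) eq
  with refl ← encodeᵇ-injective (x ∷ xs) (y ∷ ys) (2[1+_]-injective eq) = refl

encode : List ℕ → ℕ
encode = ℕᵇ.toℕ ∘ encodeᵇ

encode-injective : ∀ {xs ys} → encode xs ≡ encode ys → xs ≡ ys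
encode-injective = encodeᵇ-injective _ _ ∘ toℕ-injective

map-injective-on : {A : Set a} {P : Pred A p} (f : A → ℕ) →
  (∀ {x y} → P x → P y → f x ≡ f y → x ≡ y) →
  ∀ xs ys → (∀ {x} → x ∈ xs → P x) → (∀ {x} → x ∈ ys → P x) →
  map f xs ≡ map f ys → xs ≡ ys
map-injective-on f inj []       []       _ _ _ = refl
map-injective-on f inj (x ∷ xs) (y ∷ ys) p q eq
  with refl ← inj (p (here refl)) (q (here refl)) (Listₚ.∷-injectiveˡ eq)
  = cong (x ∷_) (map-injective-on f inj xs ys (p ∘ there) (q ∘ there) (Listₚ.∷-injectiveʳ eq))

diagonal : {A : Set a} → (ℕ → ℕ → List A) → ℕ → List A
diagonal Z n = concatMap (λ m → concatMap (Z m) (upTo n)) (upTo n)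

∈-concatMap : {A : Set a} {B : Set b} (f : A → List B) → ∀ {xs x y} →
  x ∈ xs → y ∈ f x → y ∈ concatMap f xs
∈-concatMap f {xs} x∈ y∈ = ∈-concatMap⁺ f {xs = xs} (Any.map (λ { refl → y∈ }) x∈)

∈-diagonal : {A : Set a} (Z : ℕ → ℕ → List A) → ∀ {m i x} → x ∈ Z m i →
             ∃[ n ] x ∈ diagonal Z n
∈-diagonal Z {m} {i} x∈ =
  1+ (m ℕ.⊔ i) ,
  ∈-concatMap _ (∈-upTo⁺ (s≤s (ℕₚ.m≤m⊔n m i))) (∈-concatMap (Z m) (∈-upTo⁺ (s≤s (ℕₚ.m≤n⊔m m i))) x∈)

-- Suffixes

-- Enumerations will be lists with the latest vertex first, so suffixes are their initial segments.
data _⊑_ {A : Set a} (K : List A) : List A → Set a where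
  refl : K ⊑ K
  skip : ∀ {x L} → K ⊑ L → K ⊑ (x ∷ L)

module _ {A : Set a} where

  ⊑-trans : {K L M : List A} → K ⊑ L → L ⊑ M → K ⊑ M
  ⊑-trans k refl     = k
  ⊑-trans k (skip l) = skip (⊑-trans k l)

  ⊑⇒⊆ : {K L : List A} → K ⊑ L → K ⊆ˡ L
  ⊑⇒⊆ refl     = id
  ⊑⇒⊆ (skip k) = there ∘ ⊑⇒⊆ k

  ⊑-total : {K K′ L : List A} → K ⊑ L → K′ ⊑ L → K ⊑ K′ ⊎ K′ ⊑ K
  ⊑-total k        refl      = inj₁ k
  ⊑-total refl     k′        = inj₂ k′
  ⊑-total (skip k) (skip k′) = ⊑-total k k′

  ⊑-length : {K L : List A} → K ⊑ L → length K ≤ length L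
  ⊑-length refl     = ℕₚ.≤-refl
  ⊑-length (skip k) = ℕₚ.m≤n⇒m≤1+n (⊑-length k)

  ∈⇒⊑ : ∀ {x} {L : List A} → x ∈ L → ∃[ K ] (x ∷ K) ⊑ L
  ∈⇒⊑ (here refl) = _ , refl
  ∈⇒⊑ (there x∈)  = map₂ skip (∈⇒⊑ x∈)

-- Excluded middle for untruncated types picks an element of every inhabited
-- type, so it also provides choice.
module Classical {ℓ : Level} (em : ExcludedMiddle (suc ℓ)) where

  dec : (P : Set ℓ) → Dec P
  dec P = map′ lower lift (em {Lift (suc ℓ) P})

  by-contradiction : {P : Set ℓ} → ¬ ¬ P → P
  by-contradiction {P} ¬¬p with dec P
  ... | yes p = p
  ... | no ¬p = ⊥-elim (¬¬p ¬p)

  _≟_ : {A : Set ℓ} → DecidableEquality A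
  x ≟ y = dec (x ≡ y)

  _∈?_ : {A : Set ℓ} (x : A) (xs : List A) → Dec (x ∈ xs)
  x ∈? xs = Any.any? (x ≟_) xs

  last-time : (P : ℕ → Set ℓ) (N t : ℕ) → P t → (∀ i → N ≤ i → ¬ P i) →
              ∃[ t′ ] t ≤ t′ × P t′ × (∀ i → t′ < i → ¬ P i)
  last-time P zero   t Pt none = ⊥-elim (none t z≤n Pt)
  last-time P (1+ N) t Pt none with dec (P N)
  ... | yes PN = N , ℕₚ.≮⇒≥ (λ N<t → none t N<t Pt) , PN , none
  ... | no ¬PN = last-time P N t Pt λ i N≤i → case ℕₚ.m≤n⇒m<n∨m≡n N≤i of λ
    { (inj₁ N<i) → none i N<i ; (inj₂ refl) → ¬PN }

  minimal : {A : Set ℓ} (f : A → ℕ) (P : Pred A ℓ) → ∃ P →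
            ∃[ x ] P x × (∀ {y} → P y → f x ≤ f y)
  minimal f P (x , Px) = go (f x) x ℕₚ.≤-refl Px
    where
    go : ∀ n x → f x ≤ n → P x → ∃[ x ] P x × (∀ {y} → P y → f x ≤ f y)
    go n x fx≤n Px with dec (∃[ y ] P y × f y < f x)
    go n x fx≤n Px | no none = x , Px , λ Py → ℕₚ.≮⇒≥ λ lt → none (_ , Py , lt)
    go zero x fx≤n Px | yes (y , Py , lt) = ⊥-elim (ℕₚ.n≮0 (ℕₚ.<-≤-trans lt fx≤n))
    go (1+ n) x fx≤n Px | yes (y , Py , lt) = go n y (ℕ.s≤s⁻¹ (ℕₚ.<-≤-trans lt fx≤n)) Py

  leaves-finite : {A : Set ℓ} (F : ℕ → Pred A ℓ) →
    (∀ v → ∃[ m ] ∀ n → m ≤ n → ¬ F n v) →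
    ∀ Y → ∃[ m ] ∀ n → m ≤ n → ∀ {v} → F n v → v ∉ Y
  leaves-finite F leaves [] = 0 , λ _ _ _ ()
  leaves-finite F leaves (y ∷ Y) with leaves y | leaves-finite F leaves Y
  ... | m , p | m′ , q = m ℕ.⊔ m′ , λ
    { n le Fv (here refl) → p n (ℕₚ.m⊔n≤o⇒m≤o m m′ le) Fv
    ; n le Fv (there v∈)  → q n (ℕₚ.m⊔n≤o⇒n≤o m m′ le) Fv v∈ }

  -- Reachability and components

  module InGraph (G : Graph ℓ) where
    open Graph G renaming (sym to ~-sym)

    Avoiding : List V → Rel V ℓ
    Avoiding X = Induced G (_∉ X)

    Reach : List V → Rel V ℓ
    Reach X = Star (Avoiding X)

    private variable
      X Y : List V
      u v w : V

    reach-sym : Reach X u v → Reach X v u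
    reach-sym = Star.reverse λ (p , q , e) → q , p , ~-sym e

    reach-target : u ∉ X → Reach X u v → v ∉ X
    reach-target u∉ ε                   = u∉
    reach-target u∉ ((_ , q , _) ◅ w) = reach-target q w

    reach-source : v ∉ X → Reach X u v → u ∉ X
    reach-source v∉ ε                   = v∉
    reach-source v∉ ((p , _ , _) ◅ w) = p

    reach-weaken : X ⊆ˡ Y → Reach Y u v → Reach X u v
    reach-weaken X⊆Y = Star.map λ (p , q , e) → p ∘ X⊆Y , q ∘ X⊆Y , e

    edge⇒reach : u ∉ X → v ∉ X → u ~ v → Reach X u v
    edge⇒reach u∉ v∉ e = (u∉ , v∉ , e) ◅ ε

    reach-path : u ∉ X → Reach X u v →
                 Σ[ π ∈ Path _~_ u v ] (∀ {x} → x ∈ support π → x ∉ X)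
    reach-path {X = X} u∉ w with toPath _≟_ w
    ... | π , sub with mapPath (unrestrict {R = _~_} {P = _∉ X}) π
    ...   | ρ , eq = ρ , λ x∈ →
      restricted-vertices {R = _~_} {P = _∉ X} u∉ w (sub (subst (_ ∈_) eq x∈))

    -- A walk of G - X that starts in the reachable set stays in it, so it is a walk of the induced
    -- subgraph.
    reach-connected : ∀ u → IsConnected (Reach X u) (Induced G (Reach X u))
    reach-connected {X = X} s = (s , ε) , λ {u} {v} s→u s→v →
      proj₁ (toPath _≟_ (Star.map (λ (p , q , _ , _ , e) → p , q , e)
        (restrict-closed {R = Avoiding X} {P = Reach X s}
          (λ s→u e → s→u ◅◅ Star.return e) s→u (reach-sym s→u ◅◅ s→v))))

    induced⇒reach : {C : Pred V ℓ} → Avoids G X C → Star (Induced G C) u v → Reach X u v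
    induced⇒reach avoids = Star.map λ (p , q , e) → avoids p , avoids q , e

    reach-component : u ∉ X → IsComponent G X (Reach X u)
    reach-component u∉ = record
      { avoids    = reach-target u∉
      ; connected = reach-connected _
      ; maximal   = λ D avoids (_ , paths) C⊆D d →
          induced⇒reach avoids (Path.walk (paths (C⊆D ε) d)) }

    module _ {C : Pred V ℓ} (comp : IsComponent G X C) where
      open IsComponent comp

      component-joins : C u → C v → Reach X u v
      component-joins Cu Cv = induced⇒reach avoids (Path.walk (proj₂ connected Cu Cv))

      component-closed : C u → Reach X u v → C v
      component-closed Cu =
        maximal (Reach X _) (reach-target (avoids Cu)) (reach-connected _) (component-joins Cu)

    -- Directions

    module Dir (f : Direction G) where
      open Direction f public using (at) renaming (monotone to mono)
      open Direction f using (isComponent)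

      nonempty : ∀ X → ∃ (at X)
      nonempty X = proj₁ (IsComponent.connected (isComponent X))

      avoid : at X u → u ∉ X
      avoid = IsComponent.avoids (isComponent _)

      joins : at X u → at X v → Reach X u v
      joins = component-joins (isComponent _)

      closed : at X u → Reach X u v → at X v
      closed = component-closed (isComponent _)

      neighbour : at X u → u ~ v → v ∉ X → at X v
      neighbour c e v∉ = closed c (edge⇒reach (avoid c) v∉ e)

      mono-++ˡ : at (X ++ Y) u → at X u
      mono-++ˡ = mono ∈-++⁺ˡ

      mono-++ʳ : at (X ++ Y) u → at Y u
      mono-++ʳ {X = X} = mono (∈-++⁺ʳ X)

      meet : ∀ X Y → ∃[ v ] at X v × at Y v
      meet X Y with nonempty (X ++ Y)
      ... | v , c = v , mono-++ˡ c , mono-++ʳ {X = X} c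

      reach-within : at X u → Reach X u v → Star (Induced G (at X)) u v
      reach-within c w = Star.map (λ (p , q , _ , _ , e) → p , q , e)
        (restrict-closed (λ c e → closed c (Star.return e)) c w)

      -- As a connected set missing Y, f(X) lies in one component of G - Y, and by `meet` this
      -- component is f(Y).
      absorb : (∀ {x} → at X x → x ∉ Y) → at X u → at Y u
      absorb {X = X} {Y = Y} miss cu with meet X Y
      ... | v , cv , dv = closed dv (induced⇒reach miss (reach-within cv (joins cv cu)))

    agree : ∀ (f h : Direction G) {X} → Direction.at f X u → Direction.at h X u →
            Direction.at f X ≐ Direction.at h X
    agree f h c d =
      (λ c′ → Dir.closed h d (Dir.joins f c c′)) , (λ d′ → Dir.closed f c (Dir.joins h d d′))

    -- Convergence to a direction

    Tail : (ℕ → V) → Pred V ℓ → Set ℓ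
    Tail w P = ∃[ N ] ∀ n → N ≤ n → P (w n)

    -- For a ray this says that f is the direction of its end. It is stated for arbitrary sequences
    -- because rays are obtained from convergent sequences of vertices.
    Converges : Direction G → (ℕ → V) → Set ℓ
    Converges f w = ∀ X → Tail w (Direction.at f X)

    ray-leaves : (R : Ray G) → ∀ X → ∃[ m ] ∀ n → m ≤ n → ∀ {v} → Ray.at R n ≡ v → v ∉ X
    ray-leaves R = leaves-finite (λ n v → Ray.at R n ≡ v) λ v → case dec (∃[ n ] Ray.at R n ≡ v) of λ
      { (no none)    → 0 , λ n _ eq → none (n , eq)
      ; (yes (n , eq)) → 1+ n , λ i n<i eq′ →
          ℕₚ.<⇒≢ n<i (Ray.injective R (trans eq (sym eq′))) }

    ray-reach : (R : Ray G) → ∀ {m n} → (∀ i → m ≤ i → Ray.at R i ∉ X) → m ≤ n →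
                Reach X (Ray.at R m) (Ray.at R n)
    ray-reach {X = X} R {m} {n} out m≤n = subst To (ℕₚ.m+[n∸m]≡n m≤n) (go (n ℕ.∸ m))
      where
      To : ℕ → Set ℓ
      To k = Reach X (Ray.at R m) (Ray.at R k)

      go : ∀ k → To (m + k)
      go zero   = subst To (sym (ℕₚ.+-identityʳ m)) ε
      go (1+ k) = subst To (sym (ℕₚ.+-suc m k))
        (go k ◅◅ edge⇒reach (out _ (ℕₚ.m≤m+n m k)) (out _ (ℕₚ.m≤n⇒m≤1+n (ℕₚ.m≤m+n m k)))
                  (Ray.adjacent R (m + k)))

    module _ (R : Ray G) where
      private
        start : List V → ℕ
        start X = proj₁ (ray-leaves R X)

        out : ∀ X i → start X ≤ i → Ray.at R i ∉ X
        out X i le = proj₂ (ray-leaves R X) i le refl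

      rayDirection : Direction G
      rayDirection = record
        { at          = λ X → Reach X (Ray.at R (start X))
        ; isComponent = λ X → reach-component (out X _ ℕₚ.≤-refl)
        ; monotone    = λ {X} {X′} X⊆X′ r →
            -- Along the ray, the starting point for X is joined to vertex N in G - X, and vertex N
            -- is joined to the starting point for X′ in G - X′, hence also in G - X.
            let N = start X ℕ.⊔ start X′ in
            ray-reach R (out X) (ℕₚ.m≤m⊔n _ _) ◅◅
            reach-weaken X⊆X′ (reach-sym (ray-reach R (out X′) (ℕₚ.m≤n⊔m (start X) _)) ◅◅ r) }

      rayDirection-converges : Converges rayDirection (Ray.at R)
      rayDirection-converges X = start X , λ n → ray-reach R (out X)

    module _ (f : Direction G) (R R′ : Ray G) where

      -- Tails of both rays lie in the connected set f(X), so some path between them avoids X.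
      converges⇒equivalent : Converges f (Ray.at R) → Converges f (Ray.at R′) → Equivalent G R R′
      converges⇒equivalent conv conv′ X sep with conv X | conv′ X
      ... | m , p | n , q with reach-path (Dir.avoid f (p m ℕₚ.≤-refl)) (Dir.joins f (p m ℕₚ.≤-refl) (q n ℕₚ.≤-refl))
      ...   | π , out with sep m n π
      ...     | x , x∈X , x∈π = out x∈π x∈X

      equivalent⇒converges : Converges f (Ray.at R) → Equivalent G R R′ → Converges f (Ray.at R′)
      equivalent⇒converges conv eqv X with conv X | ray-leaves R′ X
      ... | m , p | n , q = n , λ i n≤i →
        Dir.closed f p′ (ray-reach R′ (λ i n≤i → q i n≤i refl) n≤i)
        where
        -- The path may meet R and R′ before their tails avoid X, so the tails
        -- are separated by X together with the initial segments.
        initial : Ray G → ℕ → List V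
        initial R n = map (Ray.at R) (upTo n)

        p′ : Direction.at f X (Ray.at R′ n)
        p′ = by-contradiction λ no-reach → eqv (X ++ initial R m ++ initial R′ n) λ i j π →
          by-contradiction λ none →
            let miss : ∀ {x} → x ∈ support π → x ∉ X ++ initial R m ++ initial R′ n
                miss = λ x∈ x∈′ → none (_ , x∈′ , x∈)
                i≥m : m ≤ i
                i≥m = ℕₚ.≮⇒≥ λ i<m → miss (source∈ (Path.walk π))
                  (∈-++⁺ʳ X (∈-++⁺ˡ (∈-map⁺ (Ray.at R) (∈-upTo⁺ i<m))))
                j≥n : n ≤ j
                j≥n = ℕₚ.≮⇒≥ λ j<n → miss (target∈ (Path.walk π))
                  (∈-++⁺ʳ X (∈-++⁺ʳ (initial R m) (∈-map⁺ (Ray.at R′) (∈-upTo⁺ j<n))))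
            in no-reach (Dir.closed f (p i i≥m)
                 (restrict (Path.walk π) (λ x∈ x∈X → miss x∈ (∈-++⁺ˡ x∈X)) ◅◅
                  reach-sym (ray-reach R′ (λ i n≤i → q i n≤i refl) j≥n)))

    -- Rays from directions

    -- The ray leaves each vertex of the walk w after its last visit.
    module LoopErasure (w : ℕ → V) (adjacent : ∀ t → w t ~ w (1+ t))
                       (leaves : ∀ v → ∃[ N ] ∀ t → N ≤ t → w t ≢ v) where
      private
        exit : ∀ t → ∃[ t′ ] t ≤ t′ × w t′ ≡ w t × (∀ i → t′ < i → w i ≢ w t)
        exit t = last-time (λ i → w i ≡ w t) _ t refl (proj₂ (leaves (w t)))

        arrival : ℕ → ℕ

      time : ℕ → ℕ
      time k = proj₁ (exit (arrival k))

      private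
        arrival zero   = 0
        arrival (1+ k) = 1+ (time k)

        time-suc : ∀ k → time k < time (1+ k)
        time-suc k = proj₁ (proj₂ (exit (1+ (time k))))

        time-mono : ∀ {k l} → k < l → time k < time l
        time-mono {k} {1+ l} k<l with ℕₚ.m≤n⇒m<n∨m≡n (ℕ.s≤s⁻¹ k<l)
        ... | inj₁ k<l′ = ℕₚ.<-trans (time-mono k<l′) (time-suc l)
        ... | inj₂ refl = time-suc l

        at-time : ∀ k → w (time k) ≡ w (arrival k)
        at-time k = proj₁ (proj₂ (proj₂ (exit (arrival k))))

        left : ∀ {k i} → time k < i → w i ≢ w (time k)
        left {k} lt eq = proj₂ (proj₂ (proj₂ (exit (arrival k)))) _ lt (trans eq (at-time k))

      time-≥ : ∀ k → k ≤ time k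
      time-≥ zero   = z≤n
      time-≥ (1+ k) = ℕₚ.≤-<-trans (time-≥ k) (time-suc k)

      ray : Ray G
      ray = record
        { at        = w ∘ time
        ; injective = λ {k} {l} eq → case ℕₚ.<-cmp k l of λ
            { (tri< k<l _ _) → ⊥-elim (left {k} (time-mono k<l) (sym eq))
            ; (tri≈ _ k≡l _) → k≡l
            ; (tri> _ _ l<k) → ⊥-elim (left {l} (time-mono l<k) eq) }
        ; adjacent  = λ k → subst (w (time k) ~_) (sym (at-time (1+ k))) (adjacent (time k)) }

    -- The legs form an infinite walk through the points `d n`. Since every vertex eventually leaves
    -- the sets `F n`, the walk visits it only finitely often and loop erasure applies. The first
    -- edge of a leg is split off so that each step of the walk is an edge.
    module Concatenation
      (d : ℕ → V) (F : ℕ → Pred V ℓ)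
      (leg : ∀ n → ∃[ y ] Induced G (F n) (d n) y × Star (Induced G (F n)) y (d (1+ n)))
      (leaves : ∀ v → ∃[ m ] ∀ n → m ≤ n → ¬ F n v) where

      private
        record Position : Set ℓ where
          constructor position
          field
            stage  : ℕ
            vertex : V
            inside : F stage vertex
            rest   : Star (Induced G (F stage)) vertex (d (1+ stage))
        open Position

        next : Position → Position
        next (position n u c ε) with leg (1+ n)
        ... | y , (_ , c′ , _) , w        = position (1+ n) y c′ w
        next (position n u c ((_ , c′ , _) ◅ w)) = position n _ c′ w

        next-adjacent : ∀ p → vertex p ~ vertex (next p)
        next-adjacent (position n u c ε) with leg (1+ n)
        ... | y , (_ , _ , e) , w                    = e
        next-adjacent (position n u c ((_ , _ , e) ◅ w)) = e

        next-stage : ∀ p → stage p ≤ stage (next p)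
        next-stage (position n u c ε) with leg (1+ n)
        ... | y , _ , w                      = ℕₚ.n≤1+n n
        next-stage (position n u c (e ◅ w)) = ℕₚ.≤-refl

        walk : ℕ → Position
        walk zero with leg 0
        ... | y , (c , c′ , e) , w = position 0 (d 0) c ((c , c′ , e) ◅ w)
        walk (1+ t) = next (walk t)

        stage-mono : ∀ {t i} → t ≤ i → stage (walk t) ≤ stage (walk i)
        stage-mono {t} {zero} z≤n = ℕₚ.≤-refl
        stage-mono {t} {1+ i} t≤i with ℕₚ.m≤n⇒m<n∨m≡n t≤i
        ... | inj₁ t<i  = ℕₚ.≤-trans (stage-mono (ℕ.s≤s⁻¹ t<i)) (next-stage (walk i))
        ... | inj₂ refl = ℕₚ.≤-refl

        advance : ∀ t {n u c} (w : Star (Induced G (F n)) u (d (1+ n))) →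
                  walk t ≡ position n u c w → ∃[ i ] n < stage (walk i)
        advance t {n} {u} {c} ε eq = 1+ t , subst (λ p → n < stage (next p)) (sym eq) less
          where
          less : n < stage (next (position n u c ε))
          less with leg (1+ n)
          ... | _ , _ , _ = ℕₚ.≤-refl
        advance t (e ◅ w) eq = advance (1+ t) w (cong next eq)

        reaches-stage : ∀ n → ∃[ t ] n ≤ stage (walk t)
        reaches-stage zero   = 0 , z≤n
        reaches-stage (1+ n) with reaches-stage n
        ... | t , n≤ with advance t (rest (walk t)) refl
        ...   | i , lt = i , ℕₚ.≤-<-trans n≤ lt

        walk-leaves : ∀ v → ∃[ N ] ∀ t → N ≤ t → vertex (walk t) ≢ v
        walk-leaves v with leaves v
        ... | m , out with reaches-stage m
        ...   | t , m≤ = t , λ { i t≤i refl →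
          out _ (ℕₚ.≤-trans m≤ (stage-mono t≤i)) (inside (walk i)) }

      open LoopErasure (vertex ∘ walk) (next-adjacent ∘ walk) walk-leaves public using (ray)
      private module L = LoopErasure (vertex ∘ walk) (next-adjacent ∘ walk) walk-leaves

      -- A vertex of stage n is joined to `d (1+ n)` inside `F n`. For large n this set avoids X,
      -- while `d (1+ n)` lies in f(X).
      ray-converges : ∀ f → Converges f d → Converges f (Ray.at ray)
      ray-converges f conv X with conv X | leaves-finite F leaves X
      ... | m , in-f | m′ , avoids with reaches-stage (m ℕ.⊔ m′)
      ...   | t , m≤ = t , λ k t≤k →
        let p   = walk (L.time k)
            le  = ℕₚ.≤-trans m≤ (stage-mono (ℕₚ.≤-trans t≤k (L.time-≥ k)))
            m≤n  = ℕₚ.m⊔n≤o⇒m≤o m m′ le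
            m′≤n = ℕₚ.m⊔n≤o⇒n≤o m m′ le
        in Dir.closed f (in-f _ (ℕₚ.m≤n⇒m≤1+n m≤n))
             (reach-sym (induced⇒reach (avoids _ m′≤n) (rest p)))

    nontrivial : {R : Rel V ℓ} → u ≢ v → Star R u v → ∃[ y ] R u y × Star R y v
    nontrivial u≢v ε       = ⊥-elim (u≢v refl)
    nontrivial u≢v (e ◅ w) = _ , e , w

    module _ (f : Direction G) where
      open Dir f

      Dominates : Pred V ℓ
      Dominates v = ∀ X → v ∉ X → at X v

      module ManyDominating (many : ∀ X → ∃[ v ] at X v × Dominates v) where
        private
          record State : Set ℓ where
            field
              used      : List V
              current   : V
              fresh     : current ∉ used
              dominates : Dominates current
          open State

          module Next (s : State) where
            choice = many (current s ∷ used s)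
            target = proj₁ choice

            target-in : at (current s ∷ used s) target
            target-in = proj₁ (proj₂ choice)

            -- The current vertex dominates f and lies outside the finite set `used s`, hence in the
            -- component f(`used s`), which also contains the target.
            path : Reach (used s) (current s) target
            path = joins (dominates s (used s) (fresh s)) (mono there target-in)

            passed = filter (λ v → dec (v ≢ target)) (vertices path) ++ used s

            target-fresh : target ∉ passed
            target-fresh t∈ with ∈-++⁻ (filter (λ v → dec (v ≢ target)) (vertices path)) t∈
            ... | inj₁ t∈path = proj₂ (∈-filter⁻ (λ v → dec (v ≢ target)) {xs = vertices path} t∈path) refl
            ... | inj₂ t∈used = avoid target-in (there t∈used)

            next : State
            next = record
              { used = passed ; current = target ; fresh = target-fresh
              ; dominates = proj₂ (proj₂ choice) }

            passed-or-target : ∀ {v} → v ∈ vertices path → v ≡ target ⊎ v ∈ passed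
            passed-or-target {v} v∈ with dec (v ≡ target)
            ... | yes eq = inj₁ eq
            ... | no v≢  = inj₂ (∈-++⁺ˡ (∈-filter⁺ (λ v → dec (v ≢ target)) v∈ v≢))

            current-passed : current s ∈ passed
            current-passed with passed-or-target (source∈ path)
            ... | inj₁ eq = ⊥-elim (avoid target-in (here (sym eq)))
            ... | inj₂ c∈ = c∈

          state : ℕ → State
          state zero with many []
          ... | v , _ , dom = record { used = [] ; current = v ; fresh = λ () ; dominates = dom }
          state (1+ n) = Next.next (state n)

          F : ℕ → Pred V ℓ
          F n v = v ∉ used (state n) × v ∈ vertices (Next.path (state n))

          used-mono : ∀ {m n} → m ≤ n → used (state m) ⊆ˡ used (state n)
          used-mono {m} {zero} z≤n = id
          used-mono {m} {1+ n} m≤n with ℕₚ.m≤n⇒m<n∨m≡n m≤n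
          ... | inj₁ m<n  =
            ∈-++⁺ʳ (filter (λ v → dec (v ≢ Next.target (state n))) (vertices (Next.path (state n)))) ∘
            used-mono (ℕ.s≤s⁻¹ m<n)
          ... | inj₂ refl = id

          leaves : ∀ v → ∃[ m ] ∀ n → m ≤ n → ¬ F n v
          leaves v with dec (∃[ n ] F n v)
          ... | no never = 0 , λ n _ Fv → never (n , Fv)
          -- Two rounds: the target of round n becomes used only at the end of round n + 1.
          ... | yes (n , _ , v∈) = 1+ (1+ n) , λ i le (v∉ , _) → v∉ (used-mono le used-later)
            where
            used-later : v ∈ used (state (1+ (1+ n)))
            used-later with Next.passed-or-target (state n) v∈
            ... | inj₁ refl = Next.current-passed (state (1+ n))
            ... | inj₂ v∈′  = used-mono (ℕₚ.n≤1+n (1+ n)) v∈′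

          leg : ∀ n → ∃[ y ] Induced G (F n) (current (state n)) y ×
                             Star (Induced G (F n)) y (current (state (1+ n)))
          leg n = nontrivial (λ eq → avoid target-in (here (sym eq)))
            (Star.map (λ (v∈ , w∈ , p , q , e) → (p , v∈) , (q , w∈) , e) (restrict path id))
            where open Next (state n)

          current-converges : Converges f (current ∘ state)
          current-converges X with leaves-finite F leaves X
          ... | m , avoids = m , λ n m≤n →
            dominates (state n) X (avoids n m≤n (fresh (state n) , source∈ (Next.path (state n))))

        open Concatenation (current ∘ state) F leg leaves public using (ray)

        ray-converges : Converges f (Ray.at ray)
        ray-converges =
          Concatenation.ray-converges (current ∘ state) F leg leaves f current-converges

      module NoDominating (X₀ : List V) (none : ∀ v → at X₀ v → ¬ Dominates v) where
        private
          x₀ = proj₁ (nonempty X₀)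

          cut : V → List V
          cut v with dec (Σ[ Y ∈ List V ] v ∉ Y × ¬ at Y v)
          ... | yes (Y , _) = Y
          ... | no _        = []

          cut-spec : ∀ {v} → at X₀ v → v ∉ cut v × ¬ at (cut v) v
          cut-spec {v} c with dec (Σ[ Y ∈ List V ] v ∉ Y × ¬ at Y v)
          ... | yes (_ , spec) = spec
          ... | no no-cut      = ⊥-elim (none v c λ X v∉ → by-contradiction λ ¬c → no-cut (X , v∉ , ¬c))

          d : ℕ → V
          cuts : ℕ → List V
          d n = proj₁ (nonempty (cuts n))
          -- Walks back to x₀ will measure how far f has been pushed away, so x₀ is excluded from
          -- the start. Including `d n` in the next cut makes `d (1+ n)` differ from `d n`.
          cuts zero   = x₀ ∷ X₀
          cuts (1+ n) = (d n ∷ cuts n) ++ concatMap cut (cuts n)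

          d-in : ∀ n → at (cuts n) (d n)
          d-in n = proj₂ (nonempty (cuts n))

          F : ℕ → Pred V ℓ
          F n = at (cuts n)

          F-mono : ∀ {m n} → m ≤ n → F n ⊆ F m
          F-mono {m} {zero} z≤n c = c
          F-mono {m} {1+ n} m≤n c with ℕₚ.m≤n⇒m<n∨m≡n m≤n
          ... | inj₁ m<n  = F-mono (ℕ.s≤s⁻¹ m<n) (mono (∈-++⁺ˡ ∘ there) c)
          ... | inj₂ refl = c

          F⊆ : ∀ n → F n ⊆ at X₀
          F⊆ n c = mono there (F-mono {0} {n} z≤n c)

          -- Hence each cut moves f at least one step further away from x₀ in
          -- G − X₀, so that no vertex lies in all F n.
          F-neighbour : ∀ n {v b} → F (1+ n) v → v ~ b → at X₀ b → F n b
          F-neighbour n {v} {b} c e cb = by-contradiction λ b∉F →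
            let b∈ : b ∈ cuts n
                b∈ = by-contradiction λ b∉ → b∉F (neighbour (F-mono (ℕₚ.n≤1+n n) c) e b∉)
            in proj₂ (cut-spec cb) (neighbour
                 (mono (∈-++⁺ʳ (d n ∷ cuts n) ∘ ∈-concatMap cut b∈) c) e (proj₁ (cut-spec cb)))

          steps : ∀ {v} → Reach X₀ v x₀ → ℕ
          steps ε       = 0
          steps (e ◅ w) = 1+ (steps w)

          near-outside : ∀ {v} (w : Reach X₀ v x₀) → ¬ F (steps w) v
          near-outside ε                     c = avoid c (here refl)
          near-outside ((_ , b∉ , e) ◅ w) c =
            near-outside w (F-neighbour (steps w) c e (neighbour (F⊆ (1+ (steps w)) c) e b∉))

          leaves : ∀ v → ∃[ m ] ∀ n → m ≤ n → ¬ F n v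
          leaves v with dec (at X₀ v)
          ... | no v∉ = 0 , λ n _ c → v∉ (F⊆ n c)
          ... | yes c = steps v→x₀ , λ n le c → near-outside v→x₀ (F-mono le c)
            where v→x₀ = joins c (proj₂ (nonempty X₀))

          leg : ∀ n → ∃[ y ] Induced G (F n) (d n) y × Star (Induced G (F n)) y (d (1+ n))
          leg n = nontrivial (λ eq → avoid (d-in (1+ n)) (here (sym eq)))
            (reach-within (d-in n) (joins (d-in n) (F-mono (ℕₚ.n≤1+n n) (d-in (1+ n)))))

          d-converges : Converges f d
          d-converges Y with leaves-finite F leaves Y
          ... | m , avoids = m , λ n m≤n → absorb (avoids n m≤n) (d-in n)

        open Concatenation d F leg leaves public using (ray)

        ray-converges : Converges f (Ray.at ray)
        ray-converges = Concatenation.ray-converges d F leg leaves f d-converges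

      direction⇒ray : Σ[ R ∈ Ray G ] Converges f (Ray.at R)
      direction⇒ray with dec (Σ[ X ∈ List V ] (∀ v → at X v → ¬ Dominates v))
      ... | yes (X₀ , none) = ray , ray-converges
        where open NoDominating X₀ none
      ... | no some = ray , ray-converges
        where
        many : ∀ X → ∃[ v ] at X v × Dominates v
        many X = by-contradiction λ none → some (X , λ v c dom → none (v , c , dom))
        open ManyDominating many

    same-component : {C D : Pred V ℓ} → IsComponent G X C → IsComponent G Y D →
                     X ⊆ˡ Y → Y ⊆ˡ X → C u → D u → C ≐ D
    same-component cX cY X⊆Y Y⊆X Cu Du =
      (λ Cv → component-closed cY Du (reach-weaken Y⊆X (component-joins cX Cu Cv))) ,
      (λ Dv → component-closed cX Cu (reach-weaken X⊆Y (component-joins cY Du Dv)))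

    -- From normal trees to directional choices

    module FromTree (T : RootedTree G) (normal : Normal G T)
      (countable : Countable _≡_ (RootedTree.vertex T))
      (rays : ∀ ω → ∃[ R ] End.member ω R × (_ContainsRay_ G) (RootedTree.subgraph T) R) where
      open RootedTree T renaming (sym to edge-sym)

      tree-walk-vertices : vertex u → (w : Star edge u v) → ∀ {x} → x ∈ vertices w → vertex x
      tree-walk-vertices = vertices-all {P = vertex} (source ∘ edge-sym)

      ≤ᵀ⇒∈support : u ≤ᵀ v → (π : Path edge root v) → u ∈ support π
      ≤ᵀ⇒∈support (ρ , u∈) π = subst (_ ∈_)
        (acyclic⇒unique-path _≟_ (edge-sym) acyclic (Path.walk ρ) (Path.walk π)
          (Path.simple ρ) (Path.simple π)) u∈

      module _ (X₀ : List V) where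
        private
          below : V → List V
          below x with dec (vertex x)
          ... | yes x∈T = support (proj₂ connected root∈ x∈T)
          ... | no _    = []

          below⊆T : ∀ x → u ∈ below x → vertex u
          below⊆T x u∈ with dec (vertex x)
          ... | yes x∈T = tree-walk-vertices root∈ (Path.walk (proj₂ connected root∈ x∈T)) u∈

          ≤ᵀ⇒∈below : ∀ {x} → u ≤ᵀ x → u ∈ below x
          ≤ᵀ⇒∈below {x = x} (π , u∈) with dec (vertex x)
          ... | yes x∈T = ≤ᵀ⇒∈support (π , u∈) (proj₂ connected root∈ x∈T)
          ... | no x∉T  = ⊥-elim (x∉T (tree-walk-vertices root∈ (Path.walk π) (target∈ (Path.walk π))))

        closure : List V
        closure = concatMap below X₀

        closure⊆T : u ∈ closure → vertex u
        closure⊆T u∈ with Any.satisfied (∈-concatMap⁻ below {xs = X₀} u∈)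
        ... | x , u∈′ = below⊆T x u∈′

        private
          -- The tree path from u up to v avoids X₀: a vertex of X₀ on it would lie above u and so
          -- put u into the closure.
          comparable⇒reach : u ≤ᵀ v → u ∉ closure → Reach X₀ u v
          comparable⇒reach (π , u∈) u∉ =
            Star.map (λ (p , q , e) → p , q , edge⇒~ e)
              (restrict (proj₁ (drop-to (Path.walk π) u∈)) λ z∈ z∈X₀ →
                let ρ , u∈ρ , _ , uniq = take-past (Path.walk π) u∈ z∈
                in u∉ (∈-concatMap below z∈X₀
                     (≤ᵀ⇒∈below (record { walk = ρ ; simple = uniq (Path.simple π) } , u∈ρ))))

          -- Walks of this relation leave T at once and stay outside; they are the unfinished
          -- T-paths of `trace`.
          Outside : Rel V ℓ
          Outside a b = a ~ b × ¬ vertex b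

          -- With its loops removed, the excursion from u to b is a T-path, so normality makes its
          -- ends comparable and the tree path between them can replace it.
          hop : ∀ {a b} → vertex u → vertex b → u ≢ b → u ∉ closure → b ∉ closure →
                Star Outside u a → a ~ b → Reach X₀ u b
          hop {u = u} {b = b} u∈ b∈ u≢b u∉ b∉ out e with normal ρ tpath
            where
            Hop : Rel V ℓ
            Hop x y = x ~ y × (¬ vertex y ⊎ y ≡ b)

            w₀ : Star Hop u b
            w₀ = Star.map (λ (e , y∉) → e , inj₁ y∉) out ◅◅ Star.return (e , inj₂ refl)

            π+ = toPath _≟_ w₀
            ρ+ = mapPath {S = _~_} proj₁ (proj₁ π+)
            ρ  = proj₁ ρ+

            long : (w : Star _~_ u b) → 2 ≤ length (vertices w)
            long ε       = ⊥-elim (u≢b refl)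
            long (_ ◅ ε) = ℕₚ.≤-refl
            long (_ ◅ (_ ◅ _)) = s≤s (s≤s z≤n)

            on-path : ∀ {x} → x ∈ vertices w₀ → x ≡ u ⊎ (¬ vertex x ⊎ x ≡ b)
            on-path = vertices-all {P = λ x → x ≡ u ⊎ (¬ vertex x ⊎ x ≡ b)} (inj₂ ∘ proj₂) (inj₁ refl) w₀

            tpath : IsTPath G T ρ
            tpath = long (Path.walk ρ) , λ x → mk⇔
              (λ (x∈ , x∈T) → case on-path (proj₂ π+ (subst (_ ∈_) (proj₂ ρ+) x∈)) of λ
                { (inj₁ eq)         → inj₁ eq
                ; (inj₂ (inj₁ x∉T)) → ⊥-elim (x∉T x∈T)
                ; (inj₂ (inj₂ eq))  → inj₂ eq })
              λ { (inj₁ refl) → source∈ (Path.walk ρ) , u∈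
                ; (inj₂ refl) → target∈ (Path.walk ρ) , b∈ }
          ... | inj₁ u≤b = comparable⇒reach u≤b u∉
          ... | inj₂ b≤u = reach-sym (comparable⇒reach b≤u b∉)

          outside-target : ∀ {a} → Star Outside u a → vertex a → u ≡ a
          outside-target ε                 a∈ = refl
          outside-target ((_ , b∉) ◅ w) a∈ =
            ⊥-elim (vertices-all {P = ¬_ ∘ vertex} proj₂ b∉ w (target∈ w) a∈)

          -- Here u is the last vertex of T met so far, and the walk from u to a is the excursion
          -- made since.
          trace : ∀ {a} → vertex u → u ∉ closure → Star Outside u a →
                  vertex v → Reach closure a v → Reach X₀ u v
          trace u∈ u∉ out v∈ ε with refl ← outside-target out v∈ = ε
          trace {u = u} u∈ u∉ out v∈ (_◅_ {j = b} (_ , b∉ , e) w) with dec (vertex b)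
          ... | no b∉T = trace u∈ u∉ (out ◅◅ Star.return (e , b∉T)) v∈ w
          ... | yes b∈ with u ≟ b
          -- An excursion that returns to its start gives no T-path; it is dropped.
          ...   | yes refl = trace u∈ u∉ ε v∈ w
          ...   | no u≢b   = hop u∈ b∈ u≢b u∉ b∉ out e ◅◅ trace b∈ b∉ ε v∈ w

        -- Between T-paths avoiding the down-closure of X₀ ∩ T, one can walk
        -- along T: the tree path between comparable vertices outside the
        -- closure avoids X₀.
        closure-separates : vertex u → u ∉ closure → vertex v →
                            Reach closure u v → Reach X₀ u v
        closure-separates u∈ u∉ = trace u∈ u∉ ε

      -- Some ray of G has direction f. By hypothesis its end has a ray in T, and equivalence
      -- carries the convergence over.
      tree-ray : (f : Direction G) → ∃[ R ] Converges f (Ray.at R) × (∀ n → vertex (Ray.at R n))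
      tree-ray f with direction⇒ray f
      ... | R , conv with rays (record { member = Equivalent G R ; isClass = R , id , id })
      ...   | R′ , eqv , inT = R′ , equivalent⇒converges f R R′ conv eqv , source ∘ inT

      code : V → ℕ
      code = proj₁ countable

      Chosen : Pred (DirectionalChoice G) (suc ℓ)
      Chosen c = Lift (suc ℓ) ((∀ {x} → x ∈ c.X → vertex x) × ∃[ s ] vertex s × c.C s)
        where module c = DirectionalChoice c

      -- Within G - X the vertex s determines the component, so a finite list of vertices of T
      -- encodes the choice.
      choiceCode : DirectionalChoice G → ℕ
      choiceCode c with em {Chosen c}
      ... | yes (lift (_ , s , _)) = encode (code s ∷ map code (DirectionalChoice.X c))
      ... | no _                   = 0

      choiceCode-injective : ∀ {c d} → Chosen c → Chosen d → choiceCode c ≡ choiceCode d → (_≈ᶜ_ G) c d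
      choiceCode-injective {c} {d} c∈ d∈ eq with em {Chosen c} | em {Chosen d}
      ... | no c∉ | _     = ⊥-elim (c∉ c∈)
      ... | yes _ | no d∉ = ⊥-elim (d∉ d∈)
      ... | yes (lift (X⊆T , s , s∈ , Cs)) | yes (lift (Y⊆T , t , t∈ , Dt))
        with codes ← encode-injective eq
        with refl ← proj₂ countable s∈ t∈ (Listₚ.∷-injectiveˡ codes)
        = X⊆Y , Y⊆X , same-component c.isComponent d.isComponent X⊆Y Y⊆X Cs Dt
        where
        module c = DirectionalChoice c
        module d = DirectionalChoice d
        X≡Y : c.X ≡ d.X
        X≡Y = map-injective-on code (proj₂ countable) c.X d.X X⊆T Y⊆T (Listₚ.∷-injectiveʳ codes)
        X⊆Y : c.X ⊆ˡ d.X
        X⊆Y = subst (_ ∈_) X≡Y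
        Y⊆X : d.X ⊆ˡ c.X
        Y⊆X = subst (_ ∈_) (sym X≡Y)

      -- The choice is made at the closure of X₀. If f and h had the same component there, late
      -- vertices of the two tree rays would be joined outside the closure, hence by
      -- `closure-separates` outside X₀, and f(X₀) would equal h(X₀).
      tree-rays-distinguished : ∀ (f h : Direction G) {R R′ : Ray G} X₀ →
        Converges f (Ray.at R) → (∀ n → vertex (Ray.at R n)) →
        Converges h (Ray.at R′) → (∀ n → vertex (Ray.at R′ n)) →
        ¬ (Direction.at f X₀ ≐ Direction.at h X₀) → ∃[ c ] Chosen c × Distinguishes G c f h
      tree-rays-distinguished f h {R} {R′} X₀ conv R⊆T conv′ R′⊆T ne =
        record { X = X₁ ; C = f.at X₁ ; isComponent = Direction.isComponent f X₁ } ,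
        lift (closure⊆T X₀ , Ray.at R n , R⊆T n , in-f) ,
        (id , id) ,
        λ (h⊆f , f⊆h) → ne (agree f h (proj₂ (conv X₀) n (ℕₚ.m≤m⊔n m₀ _))
          (h.closed (proj₂ (conv′ X₀) n′ (ℕₚ.m≤m⊔n m₀′ _))
            (closure-separates X₀ (R′⊆T n′) (h.avoid in-h) (R⊆T n)
              (h.joins in-h (f⊆h in-f)))))
        where
        module f = Dir f
        module h = Dir h
        X₁  = closure X₀
        m₀  = proj₁ (conv X₀)
        m₀′ = proj₁ (conv′ X₀)
        n   = m₀ ℕ.⊔ proj₁ (conv X₁)
        n′  = m₀′ ℕ.⊔ proj₁ (conv′ X₁)
        in-f : f.at X₁ (Ray.at R n)
        in-f = proj₂ (conv X₁) n (ℕₚ.m≤n⊔m m₀ _)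
        in-h : h.at X₁ (Ray.at R′ n′)
        in-h = proj₂ (conv′ X₁) n′ (ℕₚ.m≤n⊔m m₀′ _)

      distinguished : (f h : Direction G) → ¬ (_≈ᵈ_ G) f h → ∃[ c ] Chosen c × Distinguishes G c f h
      distinguished f h f≉h = case em {∃[ X₀ ] Lift (suc ℓ) (¬ (Direction.at f X₀ ≐ Direction.at h X₀))} of λ
        { (no none) → ⊥-elim (f≉h λ X₀ → by-contradiction λ ne → none (X₀ , lift ne))
        ; (yes (X₀ , lift ne)) →
            let R  , conv  , R⊆T  = tree-ray f
                R′ , conv′ , R′⊆T = tree-ray h
            in tree-rays-distinguished f h {R} {R′} X₀ conv R⊆T conv′ R′⊆T ne }

      countablyDetermined : CountablyDetermined G
      countablyDetermined = Chosen , (choiceCode , choiceCode-injective) , distinguished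

    -- Normal trees from enumerations

    -- K lists, latest first, the vertices added before v.  The condition on the
    -- parent p of v says that, whenever a is joined to v in the graph minus the
    -- vertices preceding a, p does not precede a; this makes the tree-order
    -- agree with this connectivity order, for which normality is automatic.
    Parent : List V → V → V → Set ℓ
    Parent K v p = p ∈ K × p ~ v × (∀ {a K′} → (a ∷ K′) ⊑ K → Reach K′ a v → p ∉ K′)

    data Good : List V → Set ℓ where
      root : ∀ r → Good (r ∷ [])
      add  : ∀ {K v p} → Good K → v ∉ K → Parent K v p → Good (v ∷ K)

    fresh : ∀ {v K} → Good (v ∷ K) → v ∉ K
    fresh (root _)    ()
    fresh (add _ v∉ _) = v∉

    good-suffix : ∀ {v K L} → (v ∷ K) ⊑ L → Good L → Good (v ∷ K)
    good-suffix refl            g           = g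
    good-suffix (skip k) (add g _ _) = good-suffix k g

    ⊑-tail : ∀ {x y : V} {K L} → (x ∷ K) ⊑ (y ∷ L) → K ⊑ L
    ⊑-tail refl     = refl
    ⊑-tail (skip k) = ⊑-trans (skip refl) k

    ⊑-proper : ∀ {x y : V} {K L} → (x ∷ K) ⊑ (y ∷ L) → x ≢ y → (x ∷ K) ⊑ L
    ⊑-proper refl     x≢y = ⊥-elim (x≢y refl)
    ⊑-proper (skip k) _   = k

    -- Extending an enumeration

    module Extend (conn : Connected G) where

      -- For u outside K and p in K: p is a neighbour of the component of G - K that contains u.
      Exit : List V → V → Pred V ℓ
      Exit K u p = ∃[ v ] p ~ v × Reach K v u

      -- The exit is the last vertex of the walk in K. It has an outgoing edge on the walk, so it
      -- avoids K′.
      last-exit : ∀ {K K′ a} → Reach K′ a u → u ∉ K →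
                  Reach K a u ⊎ (∃[ p ] p ∈ K × p ∉ K′ × Exit K u p)
      last-exit ε u∉ = inj₁ ε
      last-exit {K = K} (_◅_ {i = a} (a∉ , _ , e) w) u∉ with last-exit w u∉
      ... | inj₂ exit  = inj₂ exit
      ... | inj₁ reach with a ∈? K
      ...   | yes a∈ = inj₂ (a , a∈ , a∉ , _ , e , reach)
      ...   | no a∉K = inj₁ ((a∉K , reach-source u∉ reach , e) ◅ reach)

      -- The first hit in the list is the vertex added last. That it is last is expressed by initial
      -- segments, the form in which `extend` needs it.
      latest : {P : Pred V ℓ} → ∀ {L p} → Good L → p ∈ L → P p →
               ∃[ q ] q ∈ L × P q × (∀ {K′} → K′ ⊑ L → q ∈ K′ → ∀ {x} → x ∈ L → P x → x ∈ K′)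
      latest (root r) (here refl) Pp = r , here refl , Pp , λ
        { refl _ x∈ _ → x∈ ; (skip refl) () }
      latest {P = P} {L = v ∷ K} {p = p} (add g v∉ _) p∈ Pp with dec (P v)
      ... | yes Pv = v , here refl , Pv , λ
        { refl _ x∈ _ → x∈ ; (skip k) v∈ → ⊥-elim (v∉ (⊑⇒⊆ k v∈)) }
      ... | no ¬Pv with latest {P = P} g (tail-∈ p∈ Pp) Pp
        where
        tail-∈ : ∀ {x} → x ∈ v ∷ K → P x → x ∈ K
        tail-∈ (here refl) Px = ⊥-elim (¬Pv Px)
        tail-∈ (there x∈)  _  = x∈
      ...   | q , q∈ , Pq , first = q , there q∈ , Pq , λ
        { refl _ x∈ _                   → x∈
        ; (skip k) q∈′ (here refl) Px → ⊥-elim (¬Pv Px)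
        ; (skip k) q∈′ (there x∈) Px  → first k q∈′ x∈ Px }

      -- A vertex just added precedes no other, so it always qualifies as the parent of its
      -- successor on the path.
      add-walk : ∀ {K p v u} → Good K → Parent K v p → (w : Star _~_ v u) →
                 Unique (vertices w) → (∀ {x} → x ∈ vertices w → x ∉ K) →
                 Σ[ L ∈ List V ] Good L × K ⊑ L × u ∈ L
      add-walk {K} {v = v} g par ε uniq out =
        v ∷ K , add g (out (here refl)) par , skip refl , here refl
      add-walk {K} {v = v} g par (e ◅ w) (v∉ ∷ uniq) out with
        add-walk (add g (out (here refl)) par)
          (here refl , e , λ { refl _ → out (here refl) ; (skip k) _ → out (here refl) ∘ ⊑⇒⊆ k ∘ there })
          w uniq (λ { x∈ (here refl) → All.lookup v∉ x∈ refl ; x∈ (there x∈K) → out (there x∈) x∈K })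
      ... | L , gL , k , u∈ = L , gL , ⊑-trans (skip refl) k , u∈

      good-inhabited : ∀ {K} → Good K → ∃[ r ] r ∈ K
      good-inhabited (root r)    = r , here refl
      good-inhabited (add _ _ _) = _ , here refl

      -- A path to u is attached at the latest vertex of K that has a neighbour in the component of
      -- u in G - K.
      extend : ∀ {K} → Good K → ∀ u → Σ[ L ∈ List V ] Good L × K ⊑ L × u ∈ L
      extend {K} g u with u ∈? K | good-inhabited g
      ... | yes u∈ | _ = K , g , refl , u∈
      ... | no u∉ | r , r∈
        with last-exit {K = K} {K′ = []}
               (Star.map (λ e → (λ ()) , (λ ()) , e) (Path.walk (proj₂ conn {r} {u} _ _))) u∉
      ...   | inj₁ reach = ⊥-elim (reach-source u∉ reach r∈)
      ...   | inj₂ (_ , p∈ , _ , exit) with latest {P = Exit K u} g p∈ exit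
      ...     | q , q∈ , (v , q~v , v→u) , first =
        let π , out = reach-path (reach-source u∉ v→u) v→u
        in add-walk g (q∈ , q~v , parent) (Path.walk π) (Path.simple π) out
        where
        parent : ∀ {a K′} → (a ∷ K′) ⊑ K → Reach K′ a v → q ∉ K′
        -- Since a lies in K, a walk from a through v to u has a last exit x from K, and x is not in
        -- K′. If q were in K′, then so would be x, as q is the latest exit.
        parent k a→v q∈′ with last-exit (a→v ◅◅ reach-weaken (⊑⇒⊆ k ∘ there) v→u) u∉
        ... | inj₁ a→u = reach-source u∉ a→u (⊑⇒⊆ k (here refl))
        ... | inj₂ (x , x∈ , x∉ , exit) = x∉ (first (⊑-trans (skip refl) k) q∈′ x∈ exit)

      extend-list : ∀ {K} → Good K → ∀ Y → Σ[ L ∈ List V ] Good L × K ⊑ L × Y ⊆ˡ L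
      extend-list {K} g []      = K , g , refl , λ ()
      extend-list     g (y ∷ Y) with extend g y
      ... | L , gL , K⊑L , y∈ with extend-list gL Y
      ...   | M , gM , L⊑M , Y⊆M = M , gM , ⊑-trans K⊑L L⊑M , λ
        { (here refl) → ⊑⇒⊆ L⊑M y∈ ; (there x∈) → Y⊆M x∈ }

      module _ (Y : ℕ → List V) where
        private
          stages : ℕ → Σ[ L ∈ List V ] Good L
          stages zero   = _ , root (proj₁ (proj₁ conn))
          stages (1+ n) with extend-list (proj₂ (stages n)) (Y n)
          ... | L , g , _ = L , g

        stage : ℕ → List V
        stage n = proj₁ (stages n)

        stage-good : ∀ n → Good (stage n)
        stage-good n = proj₂ (stages n)

        stage-suc : ∀ n → stage n ⊑ stage (1+ n)
        stage-suc n with extend-list (proj₂ (stages n)) (Y n)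
        ... | _ , _ , k , _ = k

        ⊆stage : ∀ n → Y n ⊆ˡ stage (1+ n)
        ⊆stage n with extend-list (proj₂ (stages n)) (Y n)
        ... | _ , _ , _ , sub = sub

    -- The normal tree of an increasing sequence of enumerations

    module Tree (conn : Connected G) (L : ℕ → List V) (good : ∀ n → Good (L n)) (L-suc : ∀ n → L n ⊑ L (1+ n)) where

      L-mono : ∀ {m n} → m ≤ n → L m ⊑ L n
      L-mono {m} {zero} z≤n = refl
      L-mono {m} {1+ n} m≤n with ℕₚ.m≤n⇒m<n∨m≡n m≤n
      ... | inj₁ m<n  = ⊑-trans (L-mono (ℕ.s≤s⁻¹ m<n)) (L-suc n)
      ... | inj₂ refl = refl

      Initial : Pred (List V) ℓ
      Initial K = ∃[ n ] K ⊑ L n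

      initial-⊑ : ∀ {K K′} → K ⊑ K′ → Initial K′ → Initial K
      initial-⊑ k (n , k′) = n , ⊑-trans k k′

      initial-total : ∀ {K K′} → Initial K → Initial K′ → K ⊑ K′ ⊎ K′ ⊑ K
      initial-total (m , k) (n , k′) =
        ⊑-total (⊑-trans k (L-mono (ℕₚ.m≤m⊔n m n))) (⊑-trans k′ (L-mono (ℕₚ.m≤n⊔m m n)))

      initial-good : ∀ {v K} → Initial (v ∷ K) → Good (v ∷ K)
      initial-good (n , k) = good-suffix k (good n)

      InTree : Pred V ℓ
      InTree v = ∃[ K ] Initial (v ∷ K)

      ∈-initial⇒tree : ∀ {K} → Initial K → u ∈ K → InTree u
      ∈-initial⇒tree i u∈ with ∈⇒⊑ u∈
      ... | K , k = K , initial-⊑ k i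

      finite-initial : ∀ Y → (∀ {x} → x ∈ Y → InTree x) → ∃[ n ] Y ⊆ˡ L n
      finite-initial []      _   = 0 , λ ()
      finite-initial (y ∷ Y) inT with inT (here refl) | finite-initial Y (inT ∘ there)
      ... | K , m , k | n , sub = m ℕ.⊔ n , λ
        { (here refl) → ⊑⇒⊆ (L-mono (ℕₚ.m≤m⊔n m n)) (⊑⇒⊆ k (here refl))
        ; (there x∈)  → ⊑⇒⊆ (L-mono (ℕₚ.m≤n⊔m m n)) (sub x∈) }

      predecessors-unique : ∀ {v K K′} → Initial (v ∷ K) → Initial (v ∷ K′) → K ≡ K′
      predecessors-unique i i′ with initial-total i i′
      ... | inj₁ refl     = refl
      ... | inj₁ (skip k) = ⊥-elim (fresh (initial-good i′) (⊑⇒⊆ k (here refl)))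
      ... | inj₂ refl     = refl
      ... | inj₂ (skip k) = ⊥-elim (fresh (initial-good i) (⊑⇒⊆ k (here refl)))

      -- The position of v in the enumeration, independent of the initial segment found, by
      -- `predecessors-unique`.
      code : V → ℕ
      code v with dec (InTree v)
      ... | yes (K , _) = length K
      ... | no _        = 0

      code-≡ : ∀ {v K} → Initial (v ∷ K) → code v ≡ length K
      code-≡ {v} i with dec (InTree v)
      ... | yes (_ , i′) = cong length (predecessors-unique i′ i)
      ... | no v∉        = ⊥-elim (v∉ (_ , i))

      code-< : ∀ {v K} → Initial (v ∷ K) → u ∈ K → code u < code v
      code-< {u = u} {v} {K} i u∈ with ∈⇒⊑ u∈
      ... | K′ , k rewrite code-≡ i | code-≡ (initial-⊑ (⊑-trans k (skip refl)) i) = ⊑-length k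

      code-injective : InTree u → InTree v → code u ≡ code v → u ≡ v
      code-injective (K , i) (K′ , i′) eq with initial-total i i′
      ... | inj₁ refl     = refl
      ... | inj₁ (skip k) = ⊥-elim (ℕₚ.<⇒≢ (code-< i′ (⊑⇒⊆ k (here refl))) eq)
      ... | inj₂ refl     = refl
      ... | inj₂ (skip k) = ⊥-elim (ℕₚ.<⇒≢ (code-< i (⊑⇒⊆ k (here refl))) (sym eq))

      Child : Rel V ℓ
      Child p v = ∃[ K ] Initial (v ∷ K) × Parent K v p

      child-< : Child u v → code u < code v
      child-< (K , i , u∈ , _) = code-< i u∈

      child-target : Child u v → InTree v
      child-target (K , i , _) = K , i

      child-source : Child u v → InTree u
      child-source (K , i , u∈ , _) = ∈-initial⇒tree (initial-⊑ (skip refl) i) u∈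

      predecessor-reach : ∀ {K M} → Initial (v ∷ M) → (u ∷ K) ⊑ M → u ~ v → Reach K u v
      predecessor-reach i k = edge⇒reach
        (fresh (initial-good (initial-⊑ (⊑-trans k (skip refl)) i)))
        (fresh (initial-good i) ∘ ⊑⇒⊆ k ∘ there)

      -- If one parent came before the other, the later one, being adjacent to v, would be joined to
      -- v in the graph minus its own predecessors. The parent condition then bars the earlier one
      -- from preceding it.
      child-unique : ∀ {p q} → Child p v → Child q v → p ≡ q
      child-unique (K , i , p∈ , p~v , p-late) (K′ , i′ , q∈ , q~v , q-late)
        with refl ← predecessors-unique i i′ with ∈⇒⊑ p∈ | ∈⇒⊑ q∈
      ... | P , kp | Q , kq with ⊑-total kp kq
      ...   | inj₁ refl     = refl
      ...   | inj₂ refl     = refl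
      ...   | inj₁ (skip k) = ⊥-elim (p-late kq (predecessor-reach i kq q~v) (⊑⇒⊆ k (here refl)))
      ...   | inj₂ (skip k) = ⊥-elim (q-late kp (predecessor-reach i kp p~v) (⊑⇒⊆ k (here refl)))

      -- Induction on the position of v. By the parent condition the parent p of v does not precede
      -- u, and u is joined to p through v without meeting K. So the induction hypothesis leads from
      -- u to p, and one more step to v.
      reach⇒descends : ∀ {K K′} → Initial (v ∷ K′) → (u ∷ K) ⊑ (v ∷ K′) → Reach K u v → Star Child u v
      reach⇒descends {K′ = K′} = go (length K′) ℕₚ.≤-refl
        where
        go : ∀ n {u v K K′} → length K′ ≤ n → Initial (v ∷ K′) → (u ∷ K) ⊑ (v ∷ K′) →
             Reach K u v → Star Child u v
        go n le i refl     r = ε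
        go n le i (skip k) r with initial-good i
        go n le i (skip ()) r | root _
        go n le i (skip k) r | add {p = p} _ v∉ par@(p∈ , p~v , late) with ∈⇒⊑ p∈
        ... | P , kp = go′ n (ℕₚ.≤-trans (⊑-length kp) le) ◅◅ Star.return (_ , i , par)
          where
          p∉K = late k r

          below : (_ ∷ _) ⊑ (p ∷ P)
          below with ⊑-total k kp
          ... | inj₁ k′        = k′
          ... | inj₂ refl      = refl
          ... | inj₂ (skip k′) = ⊥-elim (p∉K (⊑⇒⊆ k′ (here refl)))

          go′ : ∀ n → 1+ (length P) ≤ n → Star Child _ p
          go′ (1+ n) (s≤s le) = go n le (initial-⊑ (⊑-trans kp (skip refl)) i) below
            (r ◅◅ edge⇒reach (v∉ ∘ ⊑⇒⊆ k ∘ there) p∉K (~-sym p~v))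

      private
        bottom : ∀ {K} → Good K → ∃[ r ] (r ∷ []) ⊑ K
        bottom (root r)    = r , refl
        bottom (add g _ _) = map₂ skip (bottom g)

      top : V
      top = proj₁ (bottom (good 0))

      top-initial : Initial (top ∷ [])
      top-initial = 0 , proj₂ (bottom (good 0))

      from-top : InTree v → Star Child top v
      from-top {v = v} (K , i) with initial-total top-initial i
      ... | inj₂ refl      = ε
      ... | inj₂ (skip ())
      ... | inj₁ k         = reach⇒descends i k
        (Star.map (λ e → (λ ()) , (λ ()) , e) (Path.walk (proj₂ conn {top} {v} _ _)))

      Edge : Rel V ℓ
      Edge u v = Child u v ⊎ Child v u

      Edge-sym : Symmetric Edge
      Edge-sym = [ inj₂ , inj₁ ]′

      descends-≤ : (w : Star Child u v) → ∀ {x} → x ∈ vertices w → code u ≤ code x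
      descends-≤ ε       (here refl) = ℕₚ.≤-refl
      descends-≤ (_ ◅ _) (here refl) = ℕₚ.≤-refl
      descends-≤ (e ◅ w) (there x∈)  = ℕₚ.≤-trans (ℕₚ.<⇒≤ (child-< e)) (descends-≤ w x∈)

      descends-unique : (w : Star Child u v) → Unique (vertices w)
      descends-unique ε       = [] ∷ []
      descends-unique (e ◅ w) =
        All.tabulate (λ { x∈ refl → ℕₚ.<⇒≱ (child-< e) (descends-≤ w x∈) }) ∷ descends-unique w

      last-step : {R : Rel V ℓ} → Star R u v → u ≡ v ⊎ (∃[ x ] Star R u x × R x v)
      last-step ε       = inj₁ refl
      last-step (e ◅ w) with last-step w
      ... | inj₁ refl        = inj₂ (_ , ε , e)
      ... | inj₂ (x , w′ , f) = inj₂ (x , e ◅ w′ , f)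

      crossing : {R : Rel V ℓ} (Q : Pred V ℓ) (w : Star R u v) → Q u → ¬ Q v →
                 ∃[ x ] ∃[ y ] x ∈ vertices w × R x y × Q x × ¬ Q y
      crossing Q ε Qu ¬Qv = ⊥-elim (¬Qv Qu)
      crossing {u = u} Q (_◅_ {j = x} e w) Qu ¬Qv with dec (Q x)
      ... | no ¬Qx = u , x , here refl , e , Qu , ¬Qx
      ... | yes Qx with crossing Q w Qx ¬Qv
      ...   | a , b , a∈ , f = a , b , there a∈ , f

      -- The path has to cross from Q to its complement, which it can do only by stepping from u to
      -- v. Being simple, it consists of this one step.
      bridge⇒no-cycle : {R : Rel V ℓ} (Q : Pred V ℓ) → Q u → ¬ Q v →
        (∀ {x y} → R x y → Q x → ¬ Q y → x ≡ u × y ≡ v) →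
        (π : Path R u v) → ¬ (3 ≤ length (support π))
      bridge⇒no-cycle {R = R} Q Qu ¬Qv bridge π = go (Path.walk π) (Path.simple π)
        where
        go : (w : Star R _ _) → Unique (vertices w) → ¬ (3 ≤ length (vertices w))
        go ε       _ (s≤s ())
        go (_ ◅ ε) _ (s≤s (s≤s ()))
        go (_◅_ {j = x} e (f ◅ w)) (u∉ ∷ x∉ ∷ _) _ with dec (Q x)
        ... | no ¬Qx with refl ← proj₂ (bridge e Qu ¬Qx) = All.lookup x∉ (target∈ w) refl
        ... | yes Qx with crossing Q (f ◅ w) Qx ¬Qv
        ...   | _ , _ , a∈ , g , Qa , ¬Qb with refl ← proj₁ (bridge g Qa ¬Qb) = All.lookup u∉ a∈ refl

      -- Parents are unique, so the only edge leaving the set of descendants of c is the one from c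
      -- to its parent.
      descendants-cut : ∀ {c x y} → Edge x y → Star Child c x → ¬ Star Child c y → x ≡ c × Child y c
      descendants-cut (inj₁ e) d ¬d = ⊥-elim (¬d (d ◅◅ Star.return e))
      descendants-cut (inj₂ e) d ¬d with last-step d
      ... | inj₁ refl         = refl , e
      ... | inj₂ (_ , d′ , e′) with refl ← child-unique e e′ = ⊥-elim (¬d d′)

      parent-not-below : Child u v → ¬ Star Child v u
      parent-not-below e d = ℕₚ.<⇒≱ (child-< e) (descends-≤ d (target∈ d))

      -- The closing edge is a bridge: it alone joins the descendants of its lower end to the other
      -- vertices.
      Edge-acyclic : Acyclic Edge
      Edge-acyclic {u} {v} π long (inj₁ v↑u) =
        bridge⇒no-cycle (Star Child u) ε (parent-not-below v↑u)
          (λ e d ¬d → let eq , c = descendants-cut e d ¬d in eq , child-unique c v↑u) π long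
      Edge-acyclic {u} {v} π long (inj₂ u↑v) =
        bridge⇒no-cycle (λ x → ¬ Star Child v x) (parent-not-below u↑v) (λ ¬d → ¬d ε)
          (λ e ¬d ¬¬d → let eq , c = descendants-cut (Edge-sym e) (by-contradiction ¬¬d) ¬d
                        in child-unique c u↑v , eq) π long

      tree : RootedTree G
      tree = record
        { subgraph  = record
          { vertex  = InTree
          ; edge    = Edge
          ; edge⇒~  = λ { (inj₁ (_ , _ , _ , e , _)) → e ; (inj₂ (_ , _ , _ , e , _)) → ~-sym e }
          ; sym     = Edge-sym
          ; source  = [ child-source , child-target ]′ }
        ; connected = (top , _ , top-initial) , λ u∈ v∈ → proj₁ (toPath _≟_
            (Star.reverse inj₂ (from-top u∈) ◅◅ Star.map inj₁ (from-top v∈)))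
        ; acyclic   = Edge-acyclic
        ; root      = top
        ; root∈     = _ , top-initial }

      open RootedTree tree using (_≤ᵀ_)

      middle∈ : ∀ {x} {R : Rel V ℓ} (w : Star R u x) (w′ : Star R x v) → x ∈ vertices (w ◅◅ w′)
      middle∈ ε       w′ = source∈ w′
      middle∈ (_ ◅ w) w′ = there (middle∈ w w′)

      descends⇒≤ᵀ : InTree u → Star Child u v → u ≤ᵀ v
      descends⇒≤ᵀ u∈ d = proj₁ π+ , subst (_ ∈_) (sym (proj₂ π+)) (middle∈ (from-top u∈) d)
        where
        π+ = mapPath {S = Edge} inj₁ (record
          { walk = from-top u∈ ◅◅ d ; simple = descends-unique (from-top u∈ ◅◅ d) })

      tpath-avoids : (π : Path _~_ u v) → IsTPath G tree π → ∀ {K} → Initial K →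
                     u ∉ K → v ∉ K → Reach K u v
      tpath-avoids π (_ , meets) i u∉ v∉ = restrict (Path.walk π) λ x∈ x∈K →
        case Equivalence.to (meets _) (x∈ , ∈-initial⇒tree i x∈K) of λ
          { (inj₁ refl) → u∉ x∈K ; (inj₂ refl) → v∉ x∈K }

      -- A T-path avoids all predecessors of its earlier end, so `reach⇒descends` applies to its
      -- ends.
      normal : Normal G tree
      normal {u} {v} π tp
        with proj₂ (Equivalence.from (proj₂ tp u) (inj₁ refl))
           | proj₂ (Equivalence.from (proj₂ tp v) (inj₂ refl))
      ... | K , i | K′ , i′ with initial-total i i′
      ...   | inj₁ k = inj₁ (descends⇒≤ᵀ (K , i) (reach⇒descends i′ k
              (tpath-avoids π tp (initial-⊑ (skip refl) i) (fresh (initial-good i))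
                (fresh (initial-good i′) ∘ ⊑⇒⊆ (⊑-tail k)))))
      ...   | inj₂ k = inj₂ (descends⇒≤ᵀ (K′ , i′) (reach⇒descends i k (reach-sym
              (tpath-avoids π tp (initial-⊑ (skip refl) i′)
                (fresh (initial-good i) ∘ ⊑⇒⊆ (⊑-tail k)) (fresh (initial-good i′))))))

      -- Following a direction through the tree

      Close : Direction G → Set ℓ
      Close f = ∀ Y → (∀ {x} → x ∈ Y → InTree x) → ∃[ v ] Direction.at f Y v × InTree v

      -- From the earliest tree vertex b of f(Z), the ray moves on to the earliest tree vertex of
      -- f(Z′), where Z′ consists of b and all its predecessors. That vertex turns out to be a child
      -- of b.
      module Follow (f : Direction G) (close : Close f) where
        open Dir f

        private
          record Lowest (Z : List V) : Set ℓ where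
            field
              vertex  : V
              below   : List V
              initial : Initial (vertex ∷ below)
              in-at   : at Z vertex
              least   : ∀ {x} → at Z x → InTree x → code vertex ≤ code x

            -- By minimality no predecessor of `vertex` lies in f(Z), so `absorb` applies.
            at-below : at Z ⊆ at below
            at-below = absorb λ c x∈ → ℕₚ.<⇒≱ (code-< initial x∈)
              (least c (∈-initial⇒tree (initial-⊑ (skip refl) initial) x∈))

          lowest : ∀ Z → (∀ {x} → x ∈ Z → InTree x) → Lowest Z
          lowest Z Z⊆T with minimal code (λ v → at Z v × InTree v) (close Z Z⊆T)
          ... | b , (c , K , i) , least = record
            { vertex = b ; below = K ; initial = i ; in-at = c ; least = λ c x∈ → least (c , x∈) }

          module Step {Z : List V} (s : Lowest Z)
                      (next : Lowest (Lowest.vertex s ∷ Lowest.below s)) where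
            open Lowest s
            module N = Lowest next

            ⊑-below : (vertex ∷ below) ⊑ N.below
            ⊑-below with initial-total initial N.initial
            ... | inj₂ k        = ⊥-elim (avoid N.in-at (⊑⇒⊆ k (here refl)))
            ... | inj₁ k        = ⊑-proper k λ eq → avoid N.in-at (here (sym eq))

            -- A parent other than vertex would lie in at (vertex ∷ below),
            -- against the choice of N.vertex, or precede vertex, although
            -- vertex is joined to N.vertex in at below.
            child : Child vertex N.vertex
            child with initial-good N.initial | ⊑-below
            ... | root _ | ()
            ... | add {p = p} _ _ par@(p∈ , p~ , late) | k = N.below , N.initial ,
              subst (Parent N.below N.vertex) (p≡vertex (by-contradiction p∈′)) par
              where
              p∈′ : ¬ ¬ (p ∈ vertex ∷ below)
              p∈′ p∉ = ℕₚ.<⇒≱ (code-< N.initial p∈)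
                (N.least (neighbour N.in-at (~-sym p~) p∉)
                         (∈-initial⇒tree (initial-⊑ (skip refl) N.initial) p∈))

              p≡vertex : p ∈ vertex ∷ below → p ≡ vertex
              p≡vertex (here eq)  = eq
              p≡vertex (there p∈) = ⊥-elim (late k (joins (at-below in-at) (mono there N.in-at)) p∈)

          next : ∀ {Z} (s : Lowest Z) → Lowest (Lowest.vertex s ∷ Lowest.below s)
          next s = lowest _ (∈-initial⇒tree (Lowest.initial s))

          state : ℕ → ∃ Lowest
          state zero   = [] , lowest [] λ ()
          state (1+ n) = _ , next (proj₂ (state n))

          node : ℕ → V
          node n = Lowest.vertex (proj₂ (state n))

          node-child : ∀ n → Child (node n) (node (1+ n))
          node-child n = Step.child (proj₂ (state n)) (next (proj₂ (state n)))

          code-mono : ∀ {m n} → m < n → code (node m) < code (node n)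
          code-mono {m} {1+ n} m<n with ℕₚ.m≤n⇒m<n∨m≡n (ℕ.s≤s⁻¹ m<n)
          ... | inj₁ m<n′ = ℕₚ.<-trans (code-mono m<n′) (child-< (node-child n))
          ... | inj₂ refl = child-< (node-child n)

          code-≥ : ∀ n → n ≤ code (node n)
          code-≥ zero   = z≤n
          code-≥ (1+ n) = ℕₚ.≤-<-trans (code-≥ n) (child-< (node-child n))

        ray : Ray G
        ray = record
          { at        = node
          ; injective = λ {m} {n} eq → case ℕₚ.<-cmp m n of λ
              { (tri< m<n _ _) → ⊥-elim (ℕₚ.<⇒≢ (code-mono m<n) (cong code eq))
              ; (tri≈ _ m≡n _) → m≡n
              ; (tri> _ _ n<m) → ⊥-elim (ℕₚ.<⇒≢ (code-mono n<m) (cong code (sym eq))) }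
          ; adjacent  = λ n → Subgraph.edge⇒~ (RootedTree.subgraph tree) (inj₁ (node-child n)) }

        ray-edges : (_ContainsRay_ G) (RootedTree.subgraph tree) ray
        ray-edges n = inj₁ (node-child n)

        ray-converges-in-tree : ∀ Y → (∀ {x} → x ∈ Y → InTree x) → Tail node (at Y)
        ray-converges-in-tree Y Y⊆T with finite-initial Y Y⊆T
        -- The n-th node has position at least n, so from `length (L m)` on it and its predecessors
        -- include `L m`, which contains Y. The next node lies in f of that set, whence the shift by
        -- one.
        ... | m , Y⊆L = 1+ (length (L m)) , λ { (1+ n) (s≤s le) →
          let open Lowest (proj₂ (state n)) in
          case initial-total initial (m , refl) of λ
            { (inj₁ k) → ⊥-elim (ℕₚ.<⇒≱ (⊑-length k)
                (ℕₚ.≤-trans le (subst (n ≤_) (code-≡ initial) (code-≥ n))))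
            ; (inj₂ k) → mono (⊑⇒⊆ k ∘ Y⊆L) (Lowest.in-at (proj₂ (state (1+ n)))) } }

    -- From directional choices to normal trees

    module FromChoices (conn : Connected G) (S : Pred (DirectionalChoice G) (suc ℓ))
      (countable : Countable (_≈ᶜ_ G) S)
      (distinguish : ∀ (f h : Direction G) → ¬ (_≈ᵈ_ G) f h → ∃[ c ] S c × Distinguishes G c f h) where
      open Extend conn
      open DirectionalChoice renaming (X to set; C to part)

      choiceCode : DirectionalChoice G → ℕ
      choiceCode = proj₁ countable

      -- Components of the same G - X with a common vertex coincide, so no choice in S could tell f
      -- from h.
      agree-on-choices : ∀ (f h : Direction G) →
        (∀ {c} → S c → ∃[ v ] Direction.at f (set c) v × Direction.at h (set c) v) → (_≈ᵈ_ G) f h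
      agree-on-choices f h common = by-contradiction λ f≉h →
        let c , c∈ , (f⊆C , C⊆f) , h≠C = distinguish f h f≉h
            v , fv , hv = common c∈
            f⊆h , h⊆f = agree f h fv hv
        in h≠C ((λ p → f⊆C (h⊆f p)) , (λ p → f⊆h (C⊆f p)))

      module TreeFrom (Y : ℕ → List V) where
        open Tree conn (stage Y) (stage-good Y) (stage-suc Y) public

        ⊆tree : ∀ n → u ∈ Y n → InTree u
        ⊆tree n u∈ = ∈-initial⇒tree (1+ n , refl) (⊆stage Y n u∈)

        -- The choices in S do not distinguish f from the direction of the ray
        -- that follows f through the tree, so these are equal.
        close-ray : (∀ {c x} → S c → x ∈ set c → InTree x) → (f : Direction G) → Close f →
          Σ[ R ∈ Ray G ] ((_ContainsRay_ G) (RootedTree.subgraph tree) R × Converges f (Ray.at R))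
        close-ray covers f close = ray , ray-edges , λ X →
          let m , in-h = rayDirection-converges ray X
          in m , λ n m≤n → proj₂ (f≈h X) (in-h n m≤n)
          where
          open Follow f close
          f≈h : (_≈ᵈ_ G) f (rayDirection ray)
          f≈h = agree-on-choices f (rayDirection ray) λ {c} c∈ →
            let m  , in-f = ray-converges-in-tree (set c) (covers c∈)
                m′ , in-h = rayDirection-converges ray (set c)
            in _ , in-f (m ℕ.⊔ m′) (ℕₚ.m≤m⊔n m m′) , in-h (m ℕ.⊔ m′) (ℕₚ.m≤n⊔m m m′)

      -- Choices in S with equal codes have the same vertex set, so one choice for each code covers
      -- all of them.
      choiceSets : ℕ → List V
      choiceSets n with em {Σ[ c ∈ DirectionalChoice G ] S c × choiceCode c ≡ n}
      ... | yes (c , _) = set c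
      ... | no _        = []

      ⊆choiceSets : ∀ {c} → S c → set c ⊆ˡ choiceSets (choiceCode c)
      ⊆choiceSets {c} c∈ with em {Σ[ d ∈ DirectionalChoice G ] S d × choiceCode d ≡ choiceCode c}
      ... | yes (d , d∈ , eq) = proj₁ (proj₂ countable c∈ d∈ (sym eq))
      ... | no none           = ⊥-elim (none (c , c∈ , refl))

      module T₀ = TreeFrom choiceSets

      T₀-covers : ∀ {c x} → S c → x ∈ set c → T₀.InTree x
      T₀-covers {c} c∈ x∈ = T₀.⊆tree (choiceCode c) (⊆choiceSets c∈ x∈)

      -- N is the neighbourhood of the component f(N), which avoids T₀.
      FarAt : List V → Pred (Direction G) ℓ
      FarAt N f = (∀ {x} → x ∈ N → T₀.InTree x) ×
                  (∀ {v} → Direction.at f N v → ¬ T₀.InTree v) ×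
                  (∀ {x} → x ∈ N → ∃[ v ] Direction.at f N v × x ~ v)

      not-close⇒far : ∀ f → ¬ T₀.Close f → ∃[ N ] FarAt N f
      not-close⇒far f not-close = N , B⊆T ∘ N⊆B , (λ c → misses (at-N⊆ c)) , attached
        where
        open Dir f
        far : Σ[ B ∈ List V ] (∀ {x} → x ∈ B → T₀.InTree x) × (∀ {v} → at B v → ¬ T₀.InTree v)
        far = by-contradiction λ none → not-close λ B B⊆T → by-contradiction λ misses →
          none (B , (λ {x} → B⊆T {x}) , λ {v} c v∈ → misses (v , c , v∈))

        B = proj₁ far
        B⊆T = proj₁ (proj₂ far)

        misses : ∀ {v} → at B v → ¬ T₀.InTree v
        misses = proj₂ (proj₂ far)

        attached? : ∀ x → Dec (∃[ v ] at B v × x ~ v)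
        attached? x = dec _

        N : List V
        N = filter attached? B

        N⊆B : N ⊆ˡ B
        N⊆B x∈ = proj₁ (∈-filter⁻ attached? {xs = B} x∈)

        stays : at B u → Reach N u v → at B v
        stays c ε = c
        stays c ((_ , v∉ , e) ◅ w) = stays
          (neighbour c e λ v∈ → v∉ (∈-filter⁺ attached? v∈ (_ , c , ~-sym e))) w

        at-N⊆ : at N ⊆ at B
        at-N⊆ c = stays (proj₂ (nonempty B)) (joins (mono N⊆B (proj₂ (nonempty B))) c)

        attached : ∀ {x} → x ∈ N → ∃[ v ] at N v × x ~ v
        attached x∈ with proj₂ (∈-filter⁻ attached? {xs = B} x∈)
        ... | v , c , e = v , mono N⊆B c , e

      -- The component f(N) misses T₀, which contains the set of every choice in S.
      far-at-choice : ∀ {N f c} → FarAt N f → S c → Direction.at f N ⊆ Direction.at f (set c)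
      far-at-choice {f = f} (_ , misses , _) c∈ = Dir.absorb f λ v∈ x∈ → misses v∈ (T₀-covers c∈ x∈)

      farCode : List V → ℕ
      farCode N = encode (map T₀.code N)

      -- One direction is picked for each N. Other directions that are far at the same N are caught
      -- by `byChoice`.
      byNeighbourhood : ℕ → List (Direction G)
      byNeighbourhood k with em {Σ[ N ∈ List V ] Σ[ g ∈ Direction G ] FarAt N g × farCode N ≡ k}
      ... | yes (_ , g , _) = g ∷ []
      ... | no _            = []

      byNeighbourhood-spec : ∀ {N f} → FarAt N f → ∃[ g ] g ∈ byNeighbourhood (farCode N) × FarAt N g
      byNeighbourhood-spec {N} {f} far
        with em {Σ[ M ∈ List V ] Σ[ g ∈ Direction G ] FarAt M g × farCode M ≡ farCode N}
      ... | no none = ⊥-elim (none (N , f , far , refl))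
      ... | yes (M , g , far′ , eq) = g , here refl , subst (λ N → FarAt N g)
        (map-injective-on T₀.code T₀.code-injective M N (proj₁ far′) (proj₁ far) (encode-injective eq))
        far′

      byChoice : ℕ → List (Direction G)
      byChoice n with em {Σ[ g ∈ Direction G ] Σ[ c ∈ DirectionalChoice G ]
                            S c × choiceCode c ≡ n × Direction.at g (set c) ≐ part c}
      ... | yes (g , _) = g ∷ []
      ... | no _        = []

      byChoice-spec : ∀ {c f} → S c → Direction.at f (set c) ≐ part c →
        ∃[ g ] g ∈ byChoice (choiceCode c) × Direction.at g (set c) ⊆ Direction.at f (set c)
      byChoice-spec {c} {f} c∈ f≐
        with em {Σ[ g ∈ Direction G ] Σ[ d ∈ DirectionalChoice G ]
                   S d × choiceCode d ≡ choiceCode c × Direction.at g (set d) ≐ part d}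
      ... | no none = ⊥-elim (none (f , c , c∈ , refl , f≐))
      ... | yes (g , d , d∈ , eq , g≐) with proj₂ countable c∈ d∈ (sym eq)
      ...   | X⊆ , ⊆X , C≐ = g , here refl , λ v∈ →
        proj₂ f≐ (proj₂ C≐ (proj₁ g≐ (Direction.monotone g ⊆X v∈)))

      representatives : ℕ → List (Direction G)
      representatives n = byNeighbourhood n ++ byChoice n

      -- If f differs from the direction g chosen for N, then a choice (X , C)
      -- distinguishing them has N ⊆ X, since f(N) and g(N) have a common
      -- neighbour in each vertex of N.  Thus C ⊆ f(N), and f is the only
      -- direction in f(N), as this set avoids all choices.
      far-represented : ∀ {N f} → FarAt N f →
        ∃[ n ] ∃[ g ] g ∈ representatives n × (_≈ᵈ_ G) f g
      far-represented {N} {f} far with byNeighbourhood-spec {f = f} far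
      ... | g , g∈ , far-g with dec ((_≈ᵈ_ G) f g)
      ...   | yes f≈g = farCode N , g , ∈-++⁺ˡ g∈ , f≈g
      ...   | no f≉g with distinguish f g f≉g
      ...     | c , c∈ , f≐C , g≠C with byChoice-spec {f = f} c∈ f≐C
      ...       | h , h∈ , h⊆f =
        choiceCode c , h , ∈-++⁺ʳ (byNeighbourhood (choiceCode c)) h∈ ,
        agree-on-choices f h λ {d} d∈ →
          let v , v∈c , v∈d = Dir.meet h (set c) (set d)
          in v , far-at-choice {f = f} far d∈ (Dir.mono f N⊆X (h⊆f v∈c)) , v∈d
        where
        N⊆X : N ⊆ˡ set c
        N⊆X {x} x∈ = by-contradiction λ x∉ →
          let v  , v∈  , x~v  = proj₂ (proj₂ far) x∈
              v′ , v′∈ , x~v′ = proj₂ (proj₂ far-g) x∈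
              v′∈g = far-at-choice {f = g} far-g c∈ v′∈
              v′∈f = Dir.neighbour f (Dir.neighbour f (far-at-choice {f = f} far c∈ v∈) (~-sym x~v) x∉)
                       x~v′ (Dir.avoid g v′∈g)
              f⊆g , g⊆f = agree f g v′∈f v′∈g
          in g≠C ((λ p → proj₁ f≐C (g⊆f p)) , (λ p → f⊆g (proj₂ f≐C p)))

      rayVertices : ℕ → ℕ → List V
      rayVertices m i = map (λ g → Ray.at (proj₁ (direction⇒ray g)) i) (representatives m)

      -- T₁ is built anew, so it takes over the vertices of T₀ and of the rays, but not necessarily
      -- their edges.
      enlarged : ℕ → List V
      enlarged n = stage choiceSets n ++ diagonal rayVertices n

      module T₁ = TreeFrom enlarged

      T₀⊆T₁ : T₀.InTree u → T₁.InTree u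
      T₀⊆T₁ (_ , n , k) = T₁.⊆tree n (∈-++⁺ˡ (⊑⇒⊆ k (here refl)))

      rays⊆T₁ : ∀ {m g} i → g ∈ representatives m → T₁.InTree (Ray.at (proj₁ (direction⇒ray g)) i)
      rays⊆T₁ {m} i g∈
        with ∈-diagonal rayVertices {m} {i} (∈-map⁺ (λ g → Ray.at (proj₁ (direction⇒ray g)) i) g∈)
      ... | n , v∈ = T₁.⊆tree n (∈-++⁺ʳ (stage choiceSets n) v∈)

      ray⇒close : (f : Direction G) (R : Ray G) → (∀ n → T₁.InTree (Ray.at R n)) → Converges f (Ray.at R) → T₁.Close f
      ray⇒close f R R⊆T conv Y _ = let m , in-f = conv Y in _ , in-f m ℕₚ.≤-refl , R⊆T m

      -- It is enough that the vertices of some ray with direction f lie in T₁. Such a ray comes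
      -- from T₀ if f is close to T₀, and from a representative otherwise.
      all-close : ∀ f → T₁.Close f
      all-close f = case dec (T₀.Close f) of λ
        { (yes close) →
            let R , inT , conv = T₀.close-ray T₀-covers f close
            in ray⇒close f R (λ n → T₀⊆T₁ ([ T₀.child-source , T₀.child-target ]′ (inT n))) conv
        ; (no not-close) →
            let n , g , g∈ , f≈g = far-represented {f = f} (proj₂ (not-close⇒far f not-close))
                R , conv = direction⇒ray g
            in ray⇒close f R (λ i → rays⊆T₁ i g∈) λ Y →
                 let m , in-g = conv Y in m , λ i m≤i → proj₂ (f≈g Y) (in-g i m≤i) }

      countableNormalTree : HasCountableNormalTreeWithAllEnds G
      countableNormalTree = T₁.tree , T₁.normal , (T₁.code , T₁.code-injective) , λ ω →
        let R , _ , class⊆ = End.isClass ω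
            -- The ray of T₁ and the given ray R of the end both converge to this direction, which
            -- makes them equivalent.
            f = rayDirection R
            R′ , inT , conv = T₁.close-ray (λ c∈ x∈ → T₀⊆T₁ (T₀-covers c∈ x∈)) f (all-close f)
        in R′ , class⊆ (converges⇒equivalent f R R′ (rayDirection-converges R) conv) , inT

theorem3 : ∀ {ℓ : Level} → ExcludedMiddle (suc ℓ) →
    (G : Graph ℓ) → Connected G →
    CountablyDetermined G ⇔ HasCountableNormalTreeWithAllEnds G
theorem3 em G conn = mk⇔
  (λ (S , countable , distinguish) → FromChoices.countableNormalTree conn S countable distinguish)
  (λ (T , normal , countable , rays) → FromTree.countablyDetermined T normal countable rays)
  where open Classical.InGraph em G
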